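{- Let $k\in\mathbb{N}$. If a connected graph $G$ contains no $(\ge k)$-subdivision of $K^3$ as a geodesic subgraph and no $(\ge 3k)$-subdivision of $K_{1,3}$ as a $3$-quasi-geodesic subgraph, then there is a path $P$ such that $G$ admits an honest $P$-decomposition of radial width at most $18k+2$ and radial spread at most $18k+1$. Moreover, $P$ is $(1,18k+2)$-quasi-isometric to $G$.
   Context: All graphs are finite and simple; $\mathbb{N}=\{0,1,2,\dots\}$. $d_G$ denotes the distance in $G$. A path may consist of a single vertex. A $(\ge k)$-subdivision of a graph $X$ is a graph obtained from $X$ by replacing every edge with a path of length at least $k+1$ (new paths being internally disjoint from each other and from $V(X)$). A subgraph $Y$ of $G$ is $c$-quasi-geodesic in $G$ if $d_Y(u,v)\le c\cdot d_G(u,v)$ for all $u,v\in V(Y)$; it is geodesic if it is $1$-quasi-geodesic. Graph-decompositions: an $H$-decomposition of $G$ is a pair $(H,(V_h)_{h\in V(H)})$ with $H$ a graph and $V_h\subseteq V(G)$ (the bags) such that $\bigcup_{h}G[V_h]=G$ and, for every $v\in V(G)$, the graph $H_v:=H[\{h: v\in V_h\}]$ is connected. It is honest if all bags are non-empty and $V_h\cap V_{h'}\ne\emptyset$ for every edge $hh'$ of $H$. The radius $\mathrm{rad}(G)$ of a graph is the least $r\in\mathbb N$ such that some vertex has distance at most $r$ to all vertices ($\infty$ if the graph is disconnected). The radial width of the decomposition is $\max_h \mathrm{rad}(G[V_h])$ and its radial spread is $\max_{v\in V(G)}\mathrm{rad}(H_v)$. Quasi-isometry: for integers $L\ge1$,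 $C\ge0$, a graph $A$ is $(L,C)$-quasi-isometric to a graph $B$ if there is a map $\varphi:V(A)\to V(B)$ such that for all $a,a'\in V(A)$: $d_A(a,a')\le L\,d_B(\varphi(a),\varphi(a'))+LC$ and $d_B(\varphi(a),\varphi(a'))\le L\,d_A(a,a')+C$; and every $b\in V(B)$ satisfies $d_B(b,\varphi(a))\le C$ for some $a\in V(A)$. -}

module Defs where

open import Data.Fin as Fin using (Fin; zero; suc; toℕ; fromℕ; inject₁)
open import Data.Fin.Properties using (_≟_)
open import Data.Fin.Subset using (Subset; _∈_; _⊆_; _∩_; ⊤; Nonempty)
open import Data.Fin.Subset.Properties using (∈⊤; x∈p∩q⁺; _∈?_)
open import Data.Nat as ℕ using (ℕ; suc; _+_; _*_; _≤_; _<_)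
open import Data.Nat.Properties using (1+n≢n; <⇒≱)
open import Data.Product using (∃-syntax; _×_; _,_; proj₁; proj₂)
open import Data.Sum using (_⊎_; [_,_]; swap)
open import Data.Vec using (tabulate; lookup)
open import Level using (0ℓ)
open import Relation.Binary using (Rel; Decidable; Symmetric; Irreflexive)
open import Relation.Binary.PropositionalEquality using (_≡_; _≢_; refl; ≢-sym)
open import Relation.Nullary using (¬_)
open import Relation.Nullary.Decidable using (¬?; _×-dec_; _⊎-dec_)

-- A finite simple graph whose vertex set is a subset of Fin n. Fixing the
-- ambient type lets a graph and its subgraphs be objects of the same type.
record Graph (n : ℕ) : Set₁ where
  field
    V      : Subset n
    Adj    : Rel (Fin n) 0ℓ
    adj?   : Decidable Adj
    symm   : Symmetric Adj
    irrefl : Irreflexive _≡_ Adj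
    adj⇒∈  : ∀ {u v} → Adj u v → u ∈ V

open Graph public

private
  variable
    m n : ℕ

Vertex : Graph n → Set
Vertex G = ∃[ v ] v ∈ V G

record _⊆ᴳ_ (Y G : Graph n) : Set where
  field
    V⊆   : V Y ⊆ V G
    Adj⊆ : ∀ {u v} → Adj Y u v → Adj G u v

infix 8 _[_]

_[_] : Graph n → Subset n → Graph n
G [ S ] = record
  { V      = V G ∩ S
  ; Adj    = λ u v → Adj G u v × u ∈ S × v ∈ S
  ; adj?   = λ u v → adj? G u v ×-dec (u ∈? S) ×-dec (v ∈? S)
  ; symm   = λ (e , u∈S , v∈S) → symm G e , v∈S , u∈S
  ; irrefl = λ eq (e , _) → irrefl G eq e
  ; adj⇒∈  = λ (e , u∈S , _) → x∈p∩q⁺ (adj⇒∈ G e , u∈S)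
  }

completeGraph : ∀ n → Graph n
completeGraph n = record
  { V      = ⊤
  ; Adj    = _≢_
  ; adj?   = λ u v → ¬? (u ≟ v)
  ; symm   = ≢-sym
  ; irrefl = λ eq u≢v → u≢v eq
  ; adj⇒∈  = λ _ → ∈⊤
  }

-- K_{a,b}: the two sides are the first a and the last b elements of Fin (a + b).
completeBipartite : ∀ a b → Graph (a + b)
completeBipartite a b = record
  { V      = ⊤
  ; Adj    = λ u v → Across u v ⊎ Across v u
  ; adj?   = λ u v → across? u v ⊎-dec across? v u
  ; symm   = swap
  ; irrefl = λ { refl → [ no-loop , no-loop ] }
  ; adj⇒∈  = λ _ → ∈⊤
  }
  where
  Across : Rel (Fin (a + b)) 0ℓ
  Across u v = toℕ u < a × a ≤ toℕ v

  across? : Decidable Across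
  across? u v = (toℕ u ℕ.<? a) ×-dec (a ℕ.≤? toℕ v)

  no-loop : ∀ {u} → ¬ Across u u
  no-loop (u<a , a≤u) = <⇒≱ u<a a≤u

-- The path with ℓ edges, hence ℓ + 1 vertices.
pathGraph : ∀ ℓ → Graph (suc ℓ)
pathGraph ℓ = record
  { V      = ⊤
  ; Adj    = λ i j → Next i j ⊎ Next j i
  ; adj?   = λ i j → next? i j ⊎-dec next? j i
  ; symm   = swap
  ; irrefl = λ { refl → [ 1+n≢n , 1+n≢n ] }
  ; adj⇒∈  = λ _ → ∈⊤
  }
  where
  Next : Rel (Fin (suc ℓ)) 0ℓ
  Next i j = suc (toℕ i) ≡ toℕ j

  next? : Decidable Next
  next? i j = suc (toℕ i) ℕ.≟ toℕ j

record Path (G : Graph n) (u v : Fin n) (ℓ : ℕ) : Set where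
  field
    at        : Fin (suc ℓ) → Fin n
    source    : at zero ≡ u
    target    : at (fromℕ ℓ) ≡ v
    at∈V      : ∀ i → at i ∈ V G
    step      : ∀ (i : Fin ℓ) → Adj G (at (inject₁ i)) (at (suc i))
    injective : ∀ {i j} → at i ≡ at j → i ≡ j

  Internal : Fin n → Set
  Internal w = ∃[ i ] (0 < toℕ i × toℕ i < ℓ × at i ≡ w)

  Uses : Fin n → Fin n → Set
  Uses a b = ∃[ i ] ((at (inject₁ i) ≡ a × at (suc i) ≡ b)
                   ⊎ (at (inject₁ i) ≡ b × at (suc i) ≡ a))

Connected : Graph n → Set
Connected G = Nonempty (V G)
            × (∀ {u v} → u ∈ V G → v ∈ V G → ∃[ ℓ ] Path G u v ℓ)

-- Distances and radii may be infinite, so they are relations, not functions: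
-- Dist G u v d says that the distance is the natural number d, and it holds for
-- no d when u and v lie in different components.
Dist : Graph n → Fin n → Fin n → ℕ → Set
Dist G u v d = Path G u v d × (∀ {e} → Path G u v e → d ≤ e)

Dist≤ : Graph n → Fin n → Fin n → ℕ → Set
Dist≤ G u v r = ∃[ d ] (Dist G u v d × d ≤ r)

Centred : Graph n → ℕ → Set
Centred G r = ∃[ c ] (c ∈ V G × (∀ {v} → v ∈ V G → Dist≤ G c v r))

Rad : Graph n → ℕ → Set
Rad G r = Centred G r × (∀ {s} → Centred G s → r ≤ s)

Rad≤ : Graph n → ℕ → Set
Rad≤ G w = ∃[ r ] (Rad G r × r ≤ w)

-- The inequality is vacuous where the distance in G is infinite; where it is
-- finite, the distance in Y has to be finite too.
QuasiGeodesic : ℕ → Graph n → Graph n → Set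
QuasiGeodesic c Y G =
  ∀ {u v} → u ∈ V Y → v ∈ V Y → ∀ {d} → Dist G u v d → Dist≤ Y u v (c * d)

Geodesic : Graph n → Graph n → Set
Geodesic = QuasiGeodesic 1

-- An undirected edge, listed once by ordering its ends. The irrelevant field
-- prevents distinct proofs of adjacency from giving distinct edges.
record Edge (X : Graph m) : Set where
  field
    left right : Vertex X
    .ordered   : proj₁ left Fin.< proj₁ right
    .adjacent  : Adj X (proj₁ left) (proj₁ right)

open Edge public

record Subdivision≥ (k : ℕ) (X : Graph m) (Y : Graph n) : Set where
  field
    branch           : Vertex X → Vertex Y
    branch-injective : ∀ {x y} → proj₁ (branch x) ≡ proj₁ (branch y) → proj₁ x ≡ proj₁ y
    len              : Edge X → ℕ
    len≥             : ∀ e → k + 1 ≤ len e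
    path             : ∀ e → Path Y (proj₁ (branch (left e))) (proj₁ (branch (right e))) (len e)
    avoids-branch    : ∀ e x → ¬ Path.Internal (path e) (proj₁ (branch x))
    disjoint         : ∀ e f {w} → Path.Internal (path e) w → Path.Internal (path f) w →
                       proj₁ (left e) ≡ proj₁ (left f) × proj₁ (right e) ≡ proj₁ (right f)
    vertices-covered : ∀ {w} → w ∈ V Y →
                       (∃[ x ] proj₁ (branch x) ≡ w) ⊎ (∃[ e ] Path.Internal (path e) w)
    edges-covered    : ∀ {a b} → Adj Y a b → ∃[ e ] Path.Uses (path e) a b

-- Bags are a total function on Fin m; only those at vertices of H matter.
record Decomposition (H : Graph m) (G : Graph n) : Set where
  field
    bag : Fin m → Subset n

  hosts : Fin n → Subset m
  hosts v = tabulate (λ h → lookup (bag h) v)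

  field
    bag⊆            : ∀ {h} → h ∈ V H → bag h ⊆ V G
    covers-vertices : ∀ {v} → v ∈ V G → ∃[ h ] (h ∈ V H × v ∈ V (G [ bag h ]))
    covers-edges    : ∀ {u v} → Adj G u v → ∃[ h ] (h ∈ V H × Adj (G [ bag h ]) u v)
    hosts-connected : ∀ {v} → v ∈ V G → Connected (H [ hosts v ])

  Honest : Set
  Honest = (∀ {h} → h ∈ V H → Nonempty (bag h))
         × (∀ {h h′} → Adj H h h′ → Nonempty (bag h ∩ bag h′))

  RadialWidth≤ : ℕ → Set
  RadialWidth≤ w = ∀ {h} → h ∈ V H → Rad≤ (G [ bag h ]) w

  RadialSpread≤ : ℕ → Set
  RadialSpread≤ s = ∀ {v} → v ∈ V G → Rad≤ (H [ hosts v ]) s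

record QuasiIsometric (L C : ℕ) (A : Graph m) (B : Graph n) : Set where
  field
    φ     : Vertex A → Vertex B
    lower : ∀ a a′ {d} → Dist B (proj₁ (φ a)) (proj₁ (φ a′)) d →
            Dist≤ A (proj₁ a) (proj₁ a′) (L * d + L * C)
    upper : ∀ a a′ {d} → Dist A (proj₁ a) (proj₁ a′) d →
            Dist≤ B (proj₁ (φ a)) (proj₁ (φ a′)) (L * d + C)
    dense : ∀ {b} → b ∈ V B → ∃[ a ] Dist≤ B b (proj₁ (φ a)) C

{-# OPTIONS --safe #-}
module Submission where

open import Defs
open import Data.Bool as Bool using (Bool; true; false; _∧_; _xor_)
open import Data.Bool.Properties using (∧-comm; ∧-zeroʳ; not-injective; xor-assoc; xor-comm; xor-same)
open import Data.Empty using (⊥; ⊥-elim; ⊥-elim-irr)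
open import Data.Fin as Fin using (Fin; zero; suc; toℕ; fromℕ; fromℕ<; inject₁)
open import Data.Fin.Properties
  using (_≟_; any?; all?; toℕ<n; toℕ≤pred[n]; toℕ-injective; toℕ-fromℕ; toℕ-fromℕ<; toℕ-inject₁)
open import Data.Fin.Subset using (Subset; _∈_; _∩_; Nonempty; ⊤)
open import Data.Fin.Subset.Properties using (_∈?_; ∈⊤; x∈p∩q⁺; x∈p∩q⁻)
open import Data.Nat hiding (parity; _≟_)
open import Data.Nat.Induction using (<-rec)
open import Data.Nat.Properties hiding (_≟_)
open import Data.Nat.Tactic.RingSolver using (solve-∀)
open import Data.Product using (∃-syntax; Σ-syntax; _×_; _,_; proj₁; proj₂; swap)
open import Data.Sum using (_⊎_; inj₁; inj₂; [_,_])
open import Data.Vec using (tabulate; lookup)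
open import Data.Vec.Properties using (lookup∘tabulate; lookup⇒[]=; []=⇒lookup)
open import Function using (_∘_)
open import Relation.Binary using (tri<; tri≈; tri>)
open import Relation.Binary.PropositionalEquality hiding ([_])
open import Relation.Nullary using (¬_; Dec; yes; no; does; recompute)
open import Relation.Nullary.Decidable using (map′; dec-true; dec-false; _×-dec_; _⊎-dec_; _→-dec_)
open import Relation.Unary using (Pred; Decidable)
open import Level using (0ℓ)

-- Let P be a shortest path realising the diameter ℓ of G. If ℓ ≤ 18k + 2, a single bag suffices.
-- Otherwise project each vertex x to the first of its nearest vertices on P, with index π x, at
-- distance h x. P together with a shortest path from x to P is 3-quasi-geodesic, so the claw
-- hypothesis forces every far vertex (h x > 3k) to project to within 3k of an end of P.
-- Call an edge crossing if it joins far vertices that project to different ends. A shortest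
-- closed walk with an odd number of crossing edges is a geodesic cycle, and it is long: besides
-- a crossing edge it contains a vertex that is not far. So there is none, and hence no crossing
-- edge, as it would close up through P. A vertex v with h v > 9k would then be more than ℓ away
-- from the end of P opposite to its projection, since a walk there must first descend to height
-- 3k on its own side. So h ≤ 9k everywhere, and the sets {v : |π v − i| ≤ 9k + 1} are the bags.

-- The obstacle is that a shortest closed walk through a given crossing edge need not be geodesic: a
-- shortcut may itself use that edge, and the exchange then destroys the property being minimised.
-- Counting crossing edges modulo 2 survives every exchange, because the count is additive. Among
-- far vertices this count telescopes to a comparison of the two end vertices, which is why an odd
-- closed walk cannot stay far. The constants: the feet of a crossing edge are at least ℓ - 6k
-- apart, so its ends have heights of sum at least ℓ - 6k - 1. An odd closed walk descends from both
-- of them to height at most 3k, so its length is at least ℓ - 12k, which is at least 6k + 3 and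
-- leaves room for three arcs of length k + 1 or more. The height bound is 9k = 3k + 6k: 3k is the
-- threshold for being far, and 6k pays for two errors of 3k, the height of the vertex where a walk
-- leaves the far zone and the distance of its foot from the end of P. An edge then moves π by at
-- most 9k + 1 + 9k, so windows of half-width 9k + 1 catch every edge.

private
  variable
    m n a b c d e i j : ℕ
    u v w x y z : Fin n
    G H : Graph n

-- Linear inequalities are derived from a combination l ≤ r of hypotheses by
-- an identity between semiring terms, with slack s.
linear : ∀ s {l r x y} → l ≤ r → x + r + s ≡ y + l → x ≤ y
linear s {l} {r} {x} {y} l≤r eq = +-cancelʳ-≤ r x y (begin
  x + r      ≤⟨ m≤m+n (x + r) s ⟩
  x + r + s  ≡⟨ eq ⟩
  y + l      ≤⟨ +-monoʳ-≤ y l≤r ⟩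
  y + r      ∎)
  where open ≤-Reasoning

infixr 6 _⊕_
_⊕_ : a ≤ b → c ≤ d → a + c ≤ b + d
_⊕_ = +-mono-≤

-- Minimisers, maxima and decidable subsets

least : {P : Pred ℕ 0ℓ} → Decidable P → ∀ m → P m →
        ∃[ r ] (r ≤ m × P r × (∀ {s} → P s → r ≤ s))
least P? m Pm with P? 0
... | yes P0 = 0 , z≤n , P0 , λ _ → z≤n
least P? zero    Pm | no ¬P0 = ⊥-elim (¬P0 Pm)
least P? (suc m) Pm | no ¬P0 with least (P? ∘ suc) m Pm
... | r , r≤m , Pr , min = suc r , s≤s r≤m , Pr , λ
  { {zero}  P0 → ⊥-elim (¬P0 P0)
  ; {suc s} Ps → s≤s (min Ps) }

record FirstMinimiser (f : ℕ → ℕ) (ℓ : ℕ) : Set where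
  field
    arg   : ℕ
    arg≤  : arg ≤ ℓ
    min   : ∀ {i} → i ≤ ℓ → f arg ≤ f i
    first : ∀ {i} → i < arg → f arg < f i

firstMinimiser : ∀ f ℓ → FirstMinimiser f ℓ
firstMinimiser f zero = record
  { arg = 0 ; arg≤ = z≤n ; min = λ { z≤n → ≤-refl } ; first = λ () }
firstMinimiser f (suc ℓ) with firstMinimiser f ℓ
... | record { arg = k ; arg≤ = k≤ℓ ; min = min ; first = first } with f (suc ℓ) <? f k
... | yes f< = record
  { arg   = suc ℓ
  ; arg≤  = ≤-refl
  ; min   = λ i≤ → [ (λ i< → ≤-trans (<⇒≤ f<) (min (s≤s⁻¹ i<))) , (λ { refl → ≤-refl }) ] (m≤n⇒m<n∨m≡n i≤)
  ; first = λ i< → <-≤-trans f< (min (s≤s⁻¹ i<))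
  }
... | no f≮ = record
  { arg   = k
  ; arg≤  = m≤n⇒m≤1+n k≤ℓ
  ; min   = λ i≤ → [ (λ i< → min (s≤s⁻¹ i<)) , (λ { refl → ≮⇒≥ f≮ }) ] (m≤n⇒m<n∨m≡n i≤)
  ; first = first
  }

maximum : ∀ {P : Pred (Fin n) 0ℓ} → Decidable P → ∀ (f : Fin n → ℕ) {x} → P x →
          ∃[ y ] (P y × (∀ {z} → P z → f z ≤ f y))
maximum {suc n} P? f {x} Px with any? (λ z → P? (suc z))
maximum {suc n} P? f {zero} Px | no ¬P = zero , Px , λ
  { {zero}  _  → ≤-refl
  ; {suc z} Pz → ⊥-elim (¬P (z , Pz)) }
maximum {suc n} P? f {suc x} Px | no ¬P = ⊥-elim (¬P (x , Px))
... | yes (z , Pz) with maximum (P? ∘ suc) (f ∘ suc) Pz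
...   | y , Py , max with P? zero | f zero ≤? f (suc y)
...     | yes _   | yes f0≤ = suc y , Py , λ { {zero} _ → f0≤ ; {suc _} Pz → max Pz }
...     | yes P0  | no f0≰  = zero , P0 , λ { {zero} _ → ≤-refl ; {suc _} Pz → ≤-trans (max Pz) (≰⇒≥ f0≰) }
...     | no ¬P0 | _       = suc y , Py , λ { {zero} P0 → ⊥-elim (¬P0 P0) ; {suc _} Pz → max Pz }

does-true⁻ : {A : Set} (A? : Dec A) → does A? ≡ true → A
does-true⁻ (yes a) _ = a

does-false⁻ : {A : Set} (A? : Dec A) → does A? ≡ false → ¬ A
does-false⁻ (no ¬a) _ = ¬a

comprehension : {P : Pred (Fin n) 0ℓ} → Decidable P → Subset n
comprehension P? = tabulate (λ v → does (P? v))

∈-comprehension⁺ : {P : Pred (Fin n) 0ℓ} (P? : Decidable P) → P v → v ∈ comprehension P?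
∈-comprehension⁺ {v = v} P? Pv =
  lookup⇒[]= v _ (trans (lookup∘tabulate _ v) (dec-true (P? v) Pv))

∈-comprehension⁻ : {P : Pred (Fin n) 0ℓ} (P? : Decidable P) → v ∈ comprehension P? → P v
∈-comprehension⁻ {v = v} P? v∈ with P? v in eq
... | yes Pv = Pv
... | no _ with () ← trans (sym ([]=⇒lookup v∈)) (trans (lookup∘tabulate _ v) (cong does eq))

-- Walks, distances and radii

data Walk {n} (G : Graph n) : ℕ → Fin n → Fin n → Set where
  nil  : u ∈ V G → Walk G 0 u u
  cons : Adj G u v → Walk G m v w → Walk G (suc m) u w

source∈ : Walk G m u v → u ∈ V G
source∈ (nil u∈)       = u∈
source∈ {G = G} (cons e _) = adj⇒∈ G e

target∈ : Walk G m u v → v ∈ V G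
target∈ (nil v∈)   = v∈
target∈ (cons _ W) = target∈ W

edgeWalk : (G : Graph n) → Adj G u v → Walk G 1 u v
edgeWalk G e = cons e (nil (adj⇒∈ G (symm G e)))

nil⁻ : Walk G 0 u v → u ≡ v
nil⁻ (nil _) = refl

cons⁻ : Walk G (suc m) u v → ∃[ w ] (Adj G u w × Walk G m w v)
cons⁻ (cons e W) = _ , e , W

infixr 5 _++_
_++_ : Walk G a u v → Walk G b v w → Walk G (a + b) u w
nil _    ++ X = X
cons e W ++ X = cons e (W ++ X)

snoc : Walk G m u v → Adj G v w → Walk G (suc m) u w
snoc {G = G} (nil _) e = cons e (nil (adj⇒∈ G (symm G e)))
snoc (cons f W) e = cons f (snoc W e)

reverse : Walk G m u v → Walk G m v u
reverse (nil u∈) = nil u∈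
reverse {G = G} (cons e W) = snoc (reverse W) (symm G e)

mapWalk : {G : Graph m} {H : Graph n} (f : Fin m → Fin n) →
          (∀ {u} → u ∈ V G → f u ∈ V H) → (∀ {u v} → Adj G u v → Adj H (f u) (f v)) →
          Walk G e u v → Walk H e (f u) (f v)
mapWalk f f∈ fadj (nil u∈)   = nil (f∈ u∈)
mapWalk f f∈ fadj (cons a W) = cons (fadj a) (mapWalk f f∈ fadj W)

infix 9 _‼_
_‼_ : {G : Graph n} {u v : Fin n} → Walk G m u v → ℕ → Fin n
_‼_ {u = u} _ zero      = u
_‼_ {u = u} (nil _) (suc i) = u
cons _ W ‼ suc i = W ‼ i

at-target : (W : Walk G m u v) → W ‼ m ≡ v
at-target (nil _)    = refl
at-target (cons _ W) = at-target W

at∈ : (W : Walk G m u v) → ∀ i → W ‼ i ∈ V G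
at∈ W          zero    = source∈ W
at∈ (nil u∈)   (suc i) = u∈
at∈ (cons _ W) (suc i) = at∈ W i

at-step : (W : Walk G m u v) → i < m → Adj G (W ‼ i) (W ‼ suc i)
at-step {i = zero}  (cons e W) _       = e
at-step {i = suc i} (cons e W) (s≤s i<) = at-step W i<

prefix : (W : Walk G m u v) → i ≤ m → Walk G i u (W ‼ i)
prefix {i = zero}  W          _        = nil (source∈ W)
prefix {i = suc i} (cons e W) (s≤s i≤) = cons e (prefix W i≤)

suffix : (W : Walk G m u v) → i ≤ m → Walk G (m ∸ i) (W ‼ i) v
suffix {i = zero}  W          _        = W
suffix {i = suc i} (cons _ W) (s≤s i≤) = suffix W i≤

parity : (Fin n → Fin n → Bool) → {G : Graph n} {u v : Fin n} → Walk G m u v → Bool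
parity ω (nil _) = false
parity ω (cons {u = u} {v = v} _ W) = ω u v xor parity ω W

parity-++ : ∀ ω {G : Graph n} {u v w} (W : Walk G a u v) (X : Walk G b v w) →
            parity ω (W ++ X) ≡ parity ω W xor parity ω X
parity-++ ω (nil _) X = refl
parity-++ ω (cons {u = u} {v = v} _ W) X =
  trans (cong (ω u v xor_) (parity-++ ω W X)) (sym (xor-assoc (ω u v) _ _))

parity-reverse : ∀ ω → (∀ x y → ω x y ≡ ω y x) → {G : Graph n} {u v : Fin n} (W : Walk G m u v) →
                 parity ω (reverse W) ≡ parity ω W
parity-reverse ω sy (nil _) = refl
parity-reverse {n = n} ω sy {G} (cons {u = u} {v = v} _ W) =
  trans (parity-snoc (reverse W)) (trans (cong₂ _xor_ (sy v u) (parity-reverse ω sy W)) refl)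
  where
  parity-snoc : ∀ {m x y z} (X : Walk G m x y) {e : Adj G y z} →
                parity ω (snoc X e) ≡ ω y z xor parity ω X
  parity-snoc {y = y} {z} (nil _) = refl
  parity-snoc {y = y} {z} (cons {u = s} {v = t} _ X) = begin
    ω s t xor parity ω (snoc X _)     ≡⟨ cong (ω s t xor_) (parity-snoc X) ⟩
    ω s t xor (ω y z xor parity ω X)  ≡⟨ xor-assoc (ω s t) _ _ ⟨
    (ω s t xor ω y z) xor parity ω X  ≡⟨ cong (_xor parity ω X) (xor-comm (ω s t) _) ⟩
    (ω y z xor ω s t) xor parity ω X  ≡⟨ xor-assoc (ω y z) _ _ ⟩
    ω y z xor (ω s t xor parity ω X)  ∎
    where open ≡-Reasoning

-- Carries the additivity of `parity` along with the three pieces, so that the middle one can be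
-- exchanged without any equation between walks.
record Segments {G : Graph n} {u v} (W : Walk G m u v) (i d : ℕ) (ω : Fin n → Fin n → Bool) : Set where
  field
    {rest}  : ℕ
    length≡ : i + d + rest ≡ m
    before  : Walk G i u (W ‼ i)
    middle  : Walk G d (W ‼ i) (W ‼ (i + d))
    after   : Walk G rest (W ‼ (i + d)) v
    parity≡ : parity ω W ≡ parity ω before xor (parity ω middle xor parity ω after)

segments : (W : Walk G m u v) → i + d ≤ m → ∀ ω → Segments W i d ω
segments {i = zero} {d = zero} W _ ω = record
  { length≡ = refl ; before = nil (source∈ W) ; middle = nil (source∈ W) ; after = W ; parity≡ = refl }
segments {i = zero} {d = suc d} (cons {u = u} {v = v} e W) (s≤s le) ω = record
  { length≡ = cong suc length≡ ; before = nil (source∈ (cons e W)) ; middle = cons e middle ; after = after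
  ; parity≡ = trans (cong (ω u v xor_)
                      (trans parity≡ (cong (_xor (parity ω middle xor parity ω after)) nil-parity)))
                    (sym (xor-assoc (ω u v) _ _)) }
  where
  open Segments (segments {i = zero} {d = d} W le ω)
  nil-parity : parity ω before ≡ false
  nil-parity with before
  ... | nil _ = refl
segments {i = suc i} {d = d} (cons {u = u} {v = v} e W) (s≤s le) ω = record
  { length≡ = cong suc length≡ ; before = cons e before ; middle = middle ; after = after
  ; parity≡ = trans (cong (ω u v xor_) parity≡) (sym (xor-assoc (ω u v) _ _)) }
  where open Segments (segments {i = i} {d = d} W le ω)

walk? : (G : Graph n) (m : ℕ) (u v : Fin n) → Dec (Walk G m u v)
walk? G zero u v =
  map′ (λ { (u∈ , refl) → nil u∈ }) (λ { (nil u∈) → u∈ , refl }) ((u ∈? V G) ×-dec (u ≟ v))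
walk? G (suc m) u v =
  map′ (λ (_ , e , W) → cons e W) (λ { (cons e W) → _ , e , W })
       (any? λ w → adj? G u w ×-dec walk? G m w v)

functionPath : (Y : Graph n) (ℓ : ℕ) (p : ℕ → Fin n) → u ≡ p 0 → p ℓ ≡ v →
               (∀ {i} → i ≤ ℓ → p i ∈ V Y) → (∀ {i} → i < ℓ → Adj Y (p i) (p (suc i))) →
               (∀ {i j} → i < j → j ≤ ℓ → p i ≢ p j) → Path Y u v ℓ
functionPath Y ℓ p src tgt p∈ st inj = record
  { at = λ i → p (toℕ i)
  ; source = sym src
  ; target = trans (cong p (toℕ-fromℕ ℓ)) tgt
  ; at∈V = λ i → p∈ (toℕ≤pred[n] i)
  ; step = λ i → subst (λ j → Adj Y (p j) (p (suc (toℕ i)))) (sym (toℕ-inject₁ i)) (st (toℕ<n i))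
  ; injective = λ {i} {j} eq → toℕ-injective (inj′ (toℕ≤pred[n] i) (toℕ≤pred[n] j) eq)
  }
  where
  inj′ : ∀ {i j} → i ≤ ℓ → j ≤ ℓ → p i ≡ p j → i ≡ j
  inj′ {i} {j} i≤ j≤ eq with <-cmp i j
  ... | tri< i<j _ _ = ⊥-elim (inj i<j j≤ eq)
  ... | tri≈ _ i≡j _ = i≡j
  ... | tri> _ _ j<i = ⊥-elim (inj j<i i≤ (sym eq))

path⇒walk : {G : Graph n} → Path G u v m → Walk G m u v
path⇒walk {u = u} {v} {m} {G} P =
  subst₂ (Walk G m) source target (go m at (at∈V zero) step)
  where
  open Path P
  go : ∀ ℓ (f : Fin (suc ℓ) → Fin _) → f zero ∈ V G →
       (∀ i → Adj G (f (inject₁ i)) (f (suc i))) → Walk G ℓ (f zero) (f (fromℕ ℓ))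
  go zero    f f0∈ st = nil f0∈
  go (suc ℓ) f f0∈ st = cons (st zero) (go ℓ (f ∘ suc) (adj⇒∈ G (symm G (st zero))) (st ∘ suc))

-- A repeated vertex could be cut out, which would shorten the walk. Hence distances may be computed
-- with walks, which concatenate freely, although `Dist` is defined by injective paths.
shortest⇒path : (W : Walk G m u v) → (∀ {e} → Walk G e u v → m ≤ e) → Path G u v m
shortest⇒path {G = G} {m = m} {u} {v} W short =
  functionPath G m (W ‼_) refl (at-target W) (λ {i} _ → at∈ W i) (at-step W) inj
  where
  inj : ∀ {i j} → i < j → j ≤ m → W ‼ i ≢ W ‼ j
  inj {i} {j} i<j j≤m eq =
    <⇒≱ i<j (linear 0 (short shortcut ⊕ ≤-reflexive (m+[n∸m]≡n j≤m)) (identity i j (m ∸ j) m))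
    where
    shortcut : Walk G (i + (m ∸ j)) u v
    shortcut = prefix W (≤-trans (<⇒≤ i<j) j≤m) ++ subst (λ x → Walk G (m ∸ j) x v) (sym eq) (suffix W j≤m)
    identity : ∀ i j r m → j + (i + r + m) + 0 ≡ i + (m + (j + r))
    identity = solve-∀

shortestWalk : Walk G e u v → ∃[ d ] (d ≤ e × Walk G d u v × (∀ {c} → Walk G c u v → d ≤ c))
shortestWalk {G = G} {e} {u} {v} W = least (λ m → walk? G m u v) e W

walk⇒dist≤ : ∀ {r} → Walk G e u v → e ≤ r → Dist≤ G u v r
walk⇒dist≤ W e≤r with shortestWalk W
... | d , d≤e , X , min = d , (shortest⇒path X min , min ∘ path⇒walk) , ≤-trans d≤e e≤r

dist⇒walk : Dist G u v d → Walk G d u v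
dist⇒walk = path⇒walk ∘ proj₁

dist≤? : (G : Graph n) (u v : Fin n) (r : ℕ) → Dec (Dist≤ G u v r)
dist≤? G u v r =
  map′ (λ (e , e<r , W) → walk⇒dist≤ W (s≤s⁻¹ e<r)) (λ (d , D , d≤r) → d , s≤s d≤r , dist⇒walk D)
       (anyUpTo? (λ e → walk? G e u v) (suc r))

centred⇒rad≤ : ∀ {r} → Centred G r → Rad≤ G r
centred⇒rad≤ {G = G} {r} C with least centred? r C
  where
  centred? : ∀ r → Dec (Centred G r)
  centred? r = any? λ c → (c ∈? V G) ×-dec
    map′ (λ f {v} → f v) (λ f v → f {v}) (all? λ v → (v ∈? V G) →-dec dist≤? G c v r)
... | s , s≤r , Cs , min = s , (Cs , min) , s≤r

ladder : {H : Graph n} (f : ℕ → Fin n) (a d : ℕ) → f a ∈ V H →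
         (∀ {j} → a ≤ j → j < a + d → Adj H (f j) (f (suc j))) → Walk H d (f a) (f (a + d))
ladder {H = H} f a zero    f∈ st = subst (λ b → Walk H 0 (f a) (f b)) (sym (+-identityʳ a)) (nil f∈)
ladder {H = H} f a (suc d) f∈ st =
  subst (λ b → Walk H (suc d) (f a) (f b)) (sym (+-suc a d))
    (cons first (ladder f (suc a) d (adj⇒∈ H (symm H first))
      λ a< j< → st (<⇒≤ a<) (<-≤-trans j< (≤-reflexive (sym (+-suc a d))))))
  where first = st ≤-refl (m<m+n a (s≤s z≤n))

ladder-between : {H : Graph n} (f : ℕ → Fin n) → ∀ {a b} → a ≤ b → f a ∈ V H →
                 (∀ {j} → a ≤ j → j < b → Adj H (f j) (f (suc j))) → Walk H (b ∸ a) (f a) (f b)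
ladder-between {H = H} f {a} {b} a≤b f∈ st =
  subst (λ c → Walk H (b ∸ a) (f a) (f c)) (m+[n∸m]≡n a≤b)
    (ladder f a (b ∸ a) f∈ λ a≤j j< → st a≤j (<-≤-trans j< (≤-reflexive (m+[n∸m]≡n a≤b))))

-- The pairs of inequalities express |j - c| ≤ t without truncated subtraction. A monotone walk from
-- `c` to `i` stays in this window, so `st` is asked only for edges inside it. This one lemma serves
-- the hosts of a vertex, the part of P in a bag, and the path graph itself.
span : {H : Graph n} (f : ℕ → Fin n) → ∀ {c t ℓ} →
       (∀ {j} → j < ℓ → c ≤ j + t → suc j ≤ c + t → Adj H (f j) (f (suc j))) →
       c ≤ ℓ → f c ∈ V H → f i ∈ V H → i ≤ ℓ → i ≤ c + t → c ≤ i + t →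
       ∃[ e ] (e ≤ t × Walk H e (f c) (f i))
span {i = i} f {c} {t} st c≤ℓ fc∈ fi∈ i≤ℓ i≤ c≤ with ≤-total c i
... | inj₁ c≤i = i ∸ c , m≤n+o⇒m∸n≤o i c i≤ , ladder-between f c≤i fc∈ λ c≤j j<i →
  st (<-≤-trans j<i i≤ℓ) (≤-trans c≤j (m≤m+n _ t)) (≤-trans j<i i≤)
... | inj₂ i≤c = c ∸ i , m≤n+o⇒m∸n≤o c i c≤ , reverse (ladder-between f i≤c fi∈ λ i≤j j<c →
  st (<-≤-trans j<c c≤ℓ) (≤-trans c≤ (+-monoˡ-≤ t i≤j)) (≤-trans j<c (m≤m+n c t)))

centred⇒connected : ∀ {c r} → c ∈ V G →
                    (∀ {v} → v ∈ V G → ∃[ e ] (e ≤ r × Walk G e c v)) → Connected G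
centred⇒connected {G = G} {c} c∈ walk = (c , c∈) , λ u∈ v∈ →
  let _ , _ , X = walk u∈
      _ , _ , Z = walk v∈
      d , _ , W , min = shortestWalk (reverse X ++ Z)
  in d , shortest⇒path W min

weaken-rad≤ : a ≤ b → Rad≤ G a → Rad≤ G b
weaken-rad≤ a≤b (r , R , r≤a) = r , R , ≤-trans r≤a a≤b

-- Totalised so that the vertices of the path graph become a function on ℕ, the form in which `span`
-- and `ladder` take their vertices.
clamp : ∀ ℓ → ℕ → Fin (suc ℓ)
clamp ℓ i = fromℕ< {i ⊓ ℓ} (s≤s (m⊓n≤n i ℓ))

toℕ-clamp : ∀ {ℓ} → i ≤ ℓ → toℕ (clamp ℓ i) ≡ i
toℕ-clamp i≤ = trans (toℕ-fromℕ< _) (m≤n⇒m⊓n≡m i≤)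

clamp-toℕ : ∀ {ℓ} (i : Fin (suc ℓ)) → clamp ℓ (toℕ i) ≡ i
clamp-toℕ i = toℕ-injective (toℕ-clamp (toℕ≤pred[n] i))

clamp-step : ∀ {ℓ} → i < ℓ → Adj (pathGraph ℓ) (clamp ℓ i) (clamp ℓ (suc i))
clamp-step i< = inj₁ (trans (cong suc (toℕ-clamp (<⇒≤ i<))) (sym (toℕ-clamp i<)))

-- Projection to a geodesic, and the decomposition it induces

module Metric {n} (G : Graph n) (G-connected : Connected G) where

  private
    shortest : u ∈ V G → v ∈ V G → ∃[ d ] (Walk G d u v × (∀ {e} → Walk G e u v → d ≤ e))
    shortest u∈ v∈ with proj₂ G-connected u∈ v∈
    ... | m , P with shortestWalk (path⇒walk P)
    ... | d , _ , W , min = d , W , min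

  -- The value is 0 unless both arguments are vertices of G.
  δ : Fin n → Fin n → ℕ
  δ u v with u ∈? V G | v ∈? V G
  ... | yes u∈ | yes v∈ = proj₁ (shortest u∈ v∈)
  ... | _      | _      = 0

  δ-walk : u ∈ V G → v ∈ V G → Walk G (δ u v) u v
  δ-walk {u} {v} u∈ v∈ with u ∈? V G | v ∈? V G
  ... | yes p | yes q = proj₁ (proj₂ (shortest p q))
  ... | no ¬p | _     = ⊥-elim (¬p u∈)
  ... | yes _ | no ¬q = ⊥-elim (¬q v∈)

  δ-min : Walk G e u v → δ u v ≤ e
  δ-min {u = u} {v} W with u ∈? V G | v ∈? V G
  ... | yes p | yes q = proj₂ (proj₂ (shortest p q)) W
  ... | no _  | _     = z≤n
  ... | yes _ | no _  = z≤n

  δ-step : Walk G e x y → z ∈ V G → δ x z ≤ e + δ y z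
  δ-step W z∈ = δ-min (W ++ δ-walk (target∈ W) z∈)

  module Projection {ℓ s t} (W : Walk G ℓ s t) (W-shortest : ∀ {e} → Walk G e s t → ℓ ≤ e) where

    p : ℕ → Fin n
    p = W ‼_

    p∈ : ∀ i → p i ∈ V G
    p∈ = at∈ W

    p-step : i < ℓ → Adj G (p i) (p (suc i))
    p-step = at-step W

    p-walk : i ≤ j → j ≤ ℓ → Walk G (j ∸ i) (p i) (p j)
    p-walk {i} i≤j j≤ℓ = ladder-between p i≤j (p∈ i) (λ _ j< → p-step (<-≤-trans j< j≤ℓ))

    -- Going along `W` to `p i`, then along `X`, then from `p j` to the end is no shorter than `W`.
    -- The same walk works for either order of `i` and `j`, so no case split arises.
    p-geodesic : i ≤ ℓ → j ≤ ℓ → Walk G e (p i) (p j) → j ≤ i + e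
    p-geodesic {i} {j} {e} i≤ j≤ X = linear 0 (W-shortest whole) (identity ℓ i e j (ℓ ∸ j) (m+[n∸m]≡n j≤))
      where
      whole : Walk G (i + (e + (ℓ ∸ j))) s t
      whole = p-walk z≤n i≤ ++ X ++ subst (Walk G (ℓ ∸ j) (p j)) (at-target W) (p-walk j≤ ≤-refl)
      identity : ∀ ℓ i e j r → j + r ≡ ℓ → j + (i + (e + r)) + 0 ≡ i + e + ℓ
      identity _ i e j r refl = solver i e j r
        where
        solver : ∀ i e j r → j + (i + (e + r)) + 0 ≡ i + e + (j + r)
        solver = solve-∀

    private
      nearest : ∀ x → FirstMinimiser (λ i → δ x (p i)) ℓ
      nearest x = firstMinimiser (λ i → δ x (p i)) ℓ

    π : Fin n → ℕ
    π x = FirstMinimiser.arg (nearest x)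

    h : Fin n → ℕ
    h x = δ x (p (π x))

    π≤ : ∀ x → π x ≤ ℓ
    π≤ x = FirstMinimiser.arg≤ (nearest x)

    h-min : i ≤ ℓ → h x ≤ δ x (p i)
    h-min {x = x} = FirstMinimiser.min (nearest x)

    π-first : i < π x → h x < δ x (p i)
    π-first {x = x} = FirstMinimiser.first (nearest x)

    h-walk : x ∈ V G → Walk G (h x) x (p (π x))
    h-walk {x} x∈ = δ-walk x∈ (p∈ (π x))

    h-step : Walk G e x y → h x ≤ e + h y
    h-step {x = x} {y} X = ≤-trans (h-min {x = x} (π≤ y)) (δ-step X (p∈ (π y)))

    -- The detour from foot to foot through `x` and `y` cannot beat P.
    π-step : Walk G e x y → π y ≤ π x + (h x + (e + h y))
    π-step {x = x} {y} X =
      p-geodesic (π≤ x) (π≤ y) (reverse (h-walk (source∈ X)) ++ X ++ h-walk (target∈ X))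

    h-p : i ≤ ℓ → h (p i) ≡ 0
    h-p {i} i≤ = n≤0⇒n≡0 (≤-trans (h-min {x = p i} i≤) (δ-min (nil (p∈ i))))

    π-unique : i ≤ ℓ → Walk G e x (p i) → i ≤ π x + (h x + e)
    π-unique {x = x} i≤ X = p-geodesic (π≤ x) i≤ (reverse (h-walk (source∈ X)) ++ X)

    π-unique′ : i ≤ ℓ → Walk G e x (p i) → π x ≤ i + (e + h x)
    π-unique′ {x = x} i≤ X = p-geodesic i≤ (π≤ x) (reverse X ++ h-walk (source∈ X))

    π-p : i ≤ ℓ → π (p i) ≡ i
    π-p {i} i≤ = ≤-antisym
      (≤-trans (π-unique′ i≤ (nil (p∈ i))) (≤-reflexive (trans (cong (i +_) (h-p i≤)) (+-identityʳ i))))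
      (≤-trans (π-unique i≤ (nil (p∈ i)))
               (≤-reflexive (trans (cong (λ a → π (p i) + (a + 0)) (h-p i≤)) (+-identityʳ _))))

    -- Choosing the first of the nearest vertices makes π constant on a shortest walk to p (π x).
    descend : x ∈ V G → h x ≡ suc a → ∃[ y ] (Adj G x y × h y ≡ a × π y ≡ π x)
    descend {x} {a} x∈ hx≡ with cons⁻ (subst (λ m → Walk G m x (p (π x))) hx≡ (h-walk x∈))
    ... | y , xy , Y = y , xy , hy≡a , ≤-antisym (≮⇒≥ πx≮πy) (≮⇒≥ πy≮πx)
      where
      edge : Walk G 1 x y
      edge = edgeWalk G xy
      hy≡a : h y ≡ a
      hy≡a = ≤-antisym (≤-trans (h-min {x = y} (π≤ x)) (δ-min Y))
                       (s≤s⁻¹ (≤-trans (≤-reflexive (sym hx≡)) (h-step edge)))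
      πx≮πy : ¬ π x < π y
      πx≮πy lt = <⇒≱ (π-first {x = y} lt) (≤-trans (δ-min Y) (≤-reflexive (sym hy≡a)))
      πy≮πx : ¬ π y < π x
      πy≮πx lt = <⇒≱ (π-first {x = x} lt)
        (≤-trans (δ-step edge (p∈ (π y))) (≤-reflexive (trans (cong suc hy≡a) (sym hx≡))))

    h-zero : x ∈ V G → h x ≡ 0 → x ≡ p (π x)
    h-zero {x} x∈ eq = nil⁻ (subst (λ m → Walk G m x (p (π x))) eq (h-walk x∈))

    -- Iterates `descend`: each vertex is joined to P inside its own fibre of π, losing one unit of
    -- height per step. It provides walks to P that stay in a bag, and walks to P without crossing
    -- edges.
    foot-induction : (P : Fin n → Set) → (∀ {i} → i ≤ ℓ → P (p i)) →
                     (∀ {x y} → Adj G x y → π y ≡ π x → h x ≡ suc (h y) → P y → P x) →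
                     x ∈ V G → P x
    foot-induction P base up x∈ = go _ x∈ refl
      where
      go : ∀ m {x} → x ∈ V G → h x ≡ m → P x
      go zero    {x} x∈ eq = subst P (sym (h-zero x∈ eq)) (base (π≤ x))
      go (suc m) {x} x∈ eq with descend x∈ eq
      ... | y , xy , hy , πy = up xy πy (trans eq (cong suc (sym hy))) (go m (adj⇒∈ G (symm G xy)) hy)

    -- A bag is the preimage under π of a window of half-width `t`, so the hosts of a vertex form a
    -- window around its own index. `jump` makes the windows around the indices of two adjacent
    -- vertices meet. Bags have radius at most `t + D`: first along P, then up a fibre.
    module Thickening (D t : ℕ) (h≤D : ∀ {x} → x ∈ V G → h x ≤ D)
                      (jump : ∀ {x y} → Adj G x y → π y ≤ π x + (t + t)) where

      private
        Pℓ : Graph (suc ℓ)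
        Pℓ = pathGraph ℓ

        Near : ℕ → Fin n → Set
        Near i v = v ∈ V G × π v ≤ i + t × i ≤ π v + t

        near? : ∀ i → Decidable (Near i)
        near? i v = (v ∈? V G) ×-dec (π v ≤? i + t) ×-dec (i ≤? π v + t)

        ball : Fin (suc ℓ) → Subset n
        ball i = comprehension (near? (toℕ i))

        ball⁻ : ∀ i → v ∈ ball i → Near (toℕ i) v
        ball⁻ i = ∈-comprehension⁻ (near? (toℕ i))

        ball⁺ : ∀ i → Near (toℕ i) v → v ∈ ball i
        ball⁺ i = ∈-comprehension⁺ (near? (toℕ i))

        ball-clamp⁺ : i ≤ ℓ → Near i v → v ∈ ball (clamp ℓ i)
        ball-clamp⁺ {i} i≤ N = ball⁺ (clamp ℓ i) (subst (λ j → Near j _) (sym (toℕ-clamp i≤)) N)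

        near-π : v ∈ V G → Near (π v) v
        near-π v∈ = v∈ , m≤m+n _ t , m≤m+n _ t

      common-bag : Adj G u v → π u ≤ π v → ∃[ i ] (i ≤ ℓ × Near i u × Near i v)
      common-bag {u} {v} uv πu≤πv = k , ≤-trans k≤πv (π≤ v) ,
        (adj⇒∈ G uv , ≤-trans πu≤k (m≤m+n k t) , m⊓n≤m _ _) ,
        (adj⇒∈ G (symm G uv) , πv≤k+t (⊓-sel (π u + t) (π v)) , ≤-trans k≤πv (m≤m+n _ t))
        where
        -- The last index within reach of `u`, cut off at `π v` so that it neither overshoots `v`
        -- nor exceeds ℓ.
        k = (π u + t) ⊓ π v
        k≤πv : k ≤ π v
        k≤πv = m⊓n≤n _ _
        πu≤k : π u ≤ k
        πu≤k = ⊓-glb (m≤m+n _ t) πu≤πv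
        πv≤k+t : k ≡ π u + t ⊎ k ≡ π v → π v ≤ k + t
        πv≤k+t (inj₁ eq) = ≤-trans (jump uv)
          (≤-reflexive (trans (sym (+-assoc (π u) t t)) (cong (_+ t) (sym eq))))
        πv≤k+t (inj₂ eq) = ≤-trans (m≤m+n _ t) (≤-reflexive (cong (_+ t) (sym eq)))

      shared-bag : Adj G u v → ∃[ i ] (i ≤ ℓ × Near i u × Near i v)
      shared-bag {u} {v} uv with ≤-total (π u) (π v)
      ... | inj₁ le = common-bag uv le
      ... | inj₂ ge with common-bag (symm G uv) ge
      ...   | i , i≤ , Nv , Nu = i , i≤ , Nu , Nv

      private
        hosts : Fin n → Subset (suc ℓ)
        hosts v = tabulate (λ i → lookup (ball i) v)

        hosts⁺ : ∀ i → v ∈ ball i → i ∈ hosts v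
        hosts⁺ {v} i v∈ = lookup⇒[]= i _
          (trans (lookup∘tabulate (λ i → lookup (ball i) v) i) ([]=⇒lookup v∈))

        hosts⁻ : ∀ i → i ∈ hosts v → v ∈ ball i
        hosts⁻ {v} i i∈ = lookup⇒[]= v _
          (trans (sym (lookup∘tabulate (λ i → lookup (ball i) v) i)) ([]=⇒lookup i∈))

        hosts-clamp⁺ : i ≤ ℓ → Near i v → clamp ℓ i ∈ hosts v
        hosts-clamp⁺ i≤ N = hosts⁺ (clamp ℓ _) (ball-clamp⁺ i≤ N)

        host-walk : v ∈ V G → ∀ {i} → i ∈ V (Pℓ [ hosts v ]) →
                    ∃[ e ] (e ≤ t × Walk (Pℓ [ hosts v ]) e (clamp ℓ (π v)) i)
        host-walk {v} v∈ {i} i∈ =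
          subst (λ k → ∃[ e ] (e ≤ t × Walk (Pℓ [ hosts v ]) e (clamp ℓ (π v)) k)) (clamp-toℕ i)
            (span (clamp ℓ) (λ j< c≤ ≤c → clamp-step j< , hosts-clamp⁺ (<⇒≤ j<) (v∈ , c≤ , <⇒≤ ≤c) ,
                                          hosts-clamp⁺ j< (v∈ , ≤-trans c≤ (n≤1+n _) , ≤c))
                  (π≤ v) (x∈p∩q⁺ (∈⊤ , hosts-clamp⁺ (π≤ v) (near-π v∈)))
                  (subst (_∈ V (Pℓ [ hosts v ])) (sym (clamp-toℕ i)) i∈)
                  (toℕ≤pred[n] i) (proj₂ (proj₂ N)) (proj₁ (proj₂ N)))
          where
          N : Near (toℕ i) v
          N = ball⁻ i (hosts⁻ i (proj₂ (x∈p∩q⁻ ⊤ (hosts v) i∈)))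

        near-p : i ≤ ℓ → j ≤ i + t → i ≤ j + t → Near j (p i)
        near-p {i} i≤ a b = p∈ i , subst (_≤ _) (sym (π-p i≤)) b , subst (λ k → _ ≤ k + t) (sym (π-p i≤)) a

        near-fibre : Adj G x y → π y ≡ π x → Near i x → Near i y
        near-fibre xy eq (_ , a , b) =
          adj⇒∈ G (symm G xy) , subst (_≤ _) (sym eq) a , subst (λ k → _ ≤ k + t) (sym eq) b

        centre∈ball : ∀ i → p (toℕ i) ∈ ball i
        centre∈ball i = ball⁺ i (near-p (toℕ≤pred[n] i) (m≤m+n _ t) (m≤m+n _ t))

        -- Membership in a bag depends only on π, which the descent leaves constant.
        foot-walk : ∀ i → x ∈ V G → Near (toℕ i) x → Walk (G [ ball i ]) (h x) x (p (π x))
        foot-walk i = foot-induction (λ x → Near (toℕ i) x → Walk (G [ ball i ]) (h x) x (p (π x))) base up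
          where
          base : j ≤ ℓ → Near (toℕ i) (p j) → Walk (G [ ball i ]) (h (p j)) (p j) (p (π (p j)))
          base {j} j≤ N = subst₂ (λ m k → Walk (G [ ball i ]) m (p j) (p k)) (sym (h-p j≤)) (sym (π-p j≤))
                                 (nil (x∈p∩q⁺ (p∈ j , ball⁺ i N)))
          up : Adj G x y → π y ≡ π x → h x ≡ suc (h y) →
               (Near (toℕ i) y → Walk (G [ ball i ]) (h y) y (p (π y))) →
               Near (toℕ i) x → Walk (G [ ball i ]) (h x) x (p (π x))
          up {x} xy πeq heq rec N = subst₂ (λ m k → Walk (G [ ball i ]) m x (p k)) (sym heq) πeq
            (cons (xy , ball⁺ i N , ball⁺ i N′) (rec N′))
            where N′ = near-fibre xy πeq N

        bag-walk : ∀ i → v ∈ V (G [ ball i ]) → ∃[ e ] (e ≤ t + D × Walk (G [ ball i ]) e (p (toℕ i)) v)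
        bag-walk {v} i v∈ with ball⁻ i (proj₂ (x∈p∩q⁻ (V G) (ball i) v∈))
        ... | N@(v∈G , a , b) with
          span p (λ j< c≤ ≤c → p-step j< , ball⁺ i (near-p (<⇒≤ j<) c≤ (<⇒≤ ≤c)) ,
                               ball⁺ i (near-p j< (≤-trans c≤ (n≤1+n _)) ≤c))
               (toℕ≤pred[n] i) (x∈p∩q⁺ (p∈ (toℕ i) , centre∈ball i))
               (target∈ (foot-walk i v∈G N)) (π≤ v) a b
        ...   | e , e≤ , X = e + h v , +-mono-≤ e≤ (h≤D v∈G) , X ++ reverse (foot-walk i v∈G N)

        -- An edge of P moves π by exactly one, so `jump` rules out `t = 0` as soon as the path has
        -- an edge. Consecutive bags then share a vertex of P, while a single bag may have `t = 0`.
        t-positive : i < ℓ → 1 ≤ t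
        t-positive {i} i< = positive t (subst₂ (λ a b → a ≤ b + (t + t)) (π-p i<) (π-p (<⇒≤ i<))
                                      (jump (p-step i<)))
          where
          positive : ∀ t → suc i ≤ i + (t + t) → 1 ≤ t
          positive zero    le = ⊥-elim (<⇒≱ le (≤-reflexive (+-identityʳ i)))
          positive (suc _) _  = s≤s z≤n

      decomposition : Decomposition Pℓ G
      decomposition = record
        { bag             = ball
        ; bag⊆            = λ {i} _ v∈ → proj₁ (ball⁻ i v∈)
        ; covers-vertices = λ {v} v∈ → clamp ℓ (π v) , ∈⊤ , x∈p∩q⁺ (v∈ , ball-clamp⁺ (π≤ v) (near-π v∈))
        ; covers-edges    = λ uv → let i , i≤ , Nu , Nv = shared-bag uv in
                            clamp ℓ i , ∈⊤ , uv , ball-clamp⁺ i≤ Nu , ball-clamp⁺ i≤ Nv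
        ; hosts-connected = λ {v} v∈ → centred⇒connected (host-centre v∈) (host-walk v∈)
        }
        where
        host-centre : v ∈ V G → clamp ℓ (π v) ∈ V (Pℓ [ hosts v ])
        host-centre {v} v∈ = x∈p∩q⁺ (∈⊤ , hosts-clamp⁺ (π≤ v) (near-π v∈))

      honest : Decomposition.Honest decomposition
      honest = (λ {i} _ → p (toℕ i) , centre∈ball i) , λ
        { {i} {j} (inj₁ next) → meet i j next
        ; {i} {j} (inj₂ next) → let v , v∈ = meet j i next in
                                v , x∈p∩q⁺ (swap (x∈p∩q⁻ (ball j) (ball i) v∈)) }
        where
        meet : ∀ i j → suc (toℕ i) ≡ toℕ j → Nonempty (ball i ∩ ball j)
        meet i j next = p (toℕ i) , x∈p∩q⁺
          ( centre∈ball i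
          , ball⁺ j (near-p (toℕ≤pred[n] i)
              (≤-trans (≤-reflexive (trans (sym next) (+-comm 1 (toℕ i)))) (+-monoʳ-≤ (toℕ i) 1≤t))
              (≤-trans (n≤1+n _) (≤-trans (≤-reflexive next) (m≤m+n _ t)))))
          where
          1≤t : 1 ≤ t
          1≤t = t-positive (≤-trans (≤-reflexive next) (toℕ≤pred[n] j))

      radial-width : t + D ≤ a → Decomposition.RadialWidth≤ decomposition a
      radial-width le {i} _ = weaken-rad≤ le (centred⇒rad≤
        (p (toℕ i) , x∈p∩q⁺ (p∈ (toℕ i) , centre∈ball i) , λ v∈ →
          let _ , e≤ , X = bag-walk i v∈ in walk⇒dist≤ X e≤))

      radial-spread : t ≤ a → Decomposition.RadialSpread≤ decomposition a
      radial-spread le {v} v∈ = weaken-rad≤ le (centred⇒rad≤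
        (clamp ℓ (π v) , x∈p∩q⁺ (∈⊤ , hosts-clamp⁺ (π≤ v) (near-π v∈)) , λ i∈ →
          let _ , e≤ , X = host-walk v∈ i∈ in walk⇒dist≤ X e≤))

      -- P is an isometric copy of the path graph, so the additive constant has only the heights to
      -- absorb.
      quasi-isometric : D ≤ a → QuasiIsometric 1 a Pℓ G
      quasi-isometric {a} D≤a = record
        { φ     = λ (i , _) → p (toℕ i) , p∈ (toℕ i)
        ; lower = λ (i , _) (j , _) {d} dist →
            let X = dist⇒walk dist
                e , e≤ , Z = path-walk i j (p-geodesic (toℕ≤pred[n] i) (toℕ≤pred[n] j) X)
                                           (p-geodesic (toℕ≤pred[n] j) (toℕ≤pred[n] i) (reverse X))
            in walk⇒dist≤ Z (≤-trans e≤ (≤-trans (≤-reflexive (sym (*-identityˡ d))) (m≤m+n _ _)))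
        ; upper = λ _ _ {d} dist →
            walk⇒dist≤ (mapWalk (p ∘ toℕ) (λ {i} _ → p∈ (toℕ i)) edge (dist⇒walk dist))
                       (≤-trans (≤-reflexive (sym (*-identityˡ d))) (m≤m+n _ _))
        ; dense = λ {b} b∈ → (clamp ℓ (π b) , ∈⊤) ,
            walk⇒dist≤ (subst (λ i → Walk G (h b) b (p i)) (sym (toℕ-clamp (π≤ b))) (h-walk b∈))
                       (≤-trans (h≤D b∈) D≤a)
        }
        where
        next-edge : ∀ i j → suc (toℕ i) ≡ toℕ j → Adj G (p (toℕ i)) (p (toℕ j))
        next-edge i j next = subst (λ k → Adj G (p (toℕ i)) (p k)) next
          (p-step (≤-trans (≤-reflexive next) (toℕ≤pred[n] j)))
        edge : ∀ {i j} → Adj Pℓ i j → Adj G (p (toℕ i)) (p (toℕ j))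
        edge {i} {j} (inj₁ next) = next-edge i j next
        edge {i} {j} (inj₂ next) = symm G (next-edge j i next)
        path-walk : ∀ i j {d} → toℕ j ≤ toℕ i + d → toℕ i ≤ toℕ j + d →
                    ∃[ e ] (e ≤ d × Walk Pℓ e i j)
        path-walk i j {d} a b =
          subst₂ (λ x y → ∃[ e ] (e ≤ d × Walk Pℓ e x y)) (clamp-toℕ i) (clamp-toℕ j)
            (span (clamp ℓ) (λ j< _ _ → clamp-step j<) (toℕ≤pred[n] i) ∈⊤ ∈⊤ (toℕ≤pred[n] j) a b)

-- Subdivisions as unions of strands

module Union {n q} (G : Graph n) (len : Fin q → ℕ) (at : Fin q → ℕ → Fin n)
             (len-pos : ∀ t → 0 < len t)
             (at-step : ∀ t {i} → i < len t → Adj G (at t i) (at t (suc i))) where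

  private
    On : Fin n → Set
    On v = ∃[ t ] Σ[ i ∈ Fin (suc (len t)) ] at t (toℕ i) ≡ v

    on? : Decidable On
    on? v = any? λ t → any? λ i → at t (toℕ i) ≟ v

    JoinedBy : (t : Fin q) → ℕ → ℕ → Fin n → Fin n → Set
    JoinedBy t i j u v = (at t i ≡ u × at t j ≡ v) ⊎ (at t i ≡ v × at t j ≡ u)

    -- Only consecutive positions of one strand are joined: an induced subgraph might have chords,
    -- which `edges-covered` forbids.
    Joins : Fin n → Fin n → Set
    Joins u v = ∃[ t ] Σ[ i ∈ Fin (len t) ] JoinedBy t (toℕ i) (suc (toℕ i)) u v

    joins? : ∀ u v → Dec (Joins u v)
    joins? u v = any? λ t → any? λ i →
      ((at t (toℕ i) ≟ u) ×-dec (at t (suc (toℕ i)) ≟ v)) ⊎-dec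
      ((at t (toℕ i) ≟ v) ×-dec (at t (suc (toℕ i)) ≟ u))

    joins⇒adj : Joins u v → Adj G u v
    joins⇒adj (t , i , inj₁ (refl , refl)) = at-step t (toℕ<n i)
    joins⇒adj (t , i , inj₂ (refl , refl)) = symm G (at-step t (toℕ<n i))

    on : ∀ t {i} → i ≤ len t → at t i ≡ v → On v
    on t i≤ eq = t , fromℕ< (s≤s i≤) , trans (cong (at t) (toℕ-fromℕ< (s≤s i≤))) eq

    joins⇒on : Joins u v → On u
    joins⇒on (t , i , inj₁ (eq , _)) = on t (<⇒≤ (toℕ<n i)) eq
    joins⇒on (t , i , inj₂ (_ , eq)) = on t (toℕ<n i) eq

  union : Graph n
  union = record
    { V      = comprehension on?
    ; Adj    = Joins
    ; adj?   = joins?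
    ; symm   = λ (t , i , j) → t , i , [ inj₂ , inj₁ ] j
    ; irrefl = λ eq j → irrefl G eq (joins⇒adj j)
    ; adj⇒∈  = λ j → ∈-comprehension⁺ on? (joins⇒on j)
    }

  union∈⁺ : ∀ t {i} → i ≤ len t → at t i ∈ V union
  union∈⁺ t i≤ = ∈-comprehension⁺ on? (on t i≤ refl)

  union∈⁻ : v ∈ V union → ∃[ t ] ∃[ i ] (i ≤ len t × at t i ≡ v)
  union∈⁻ v∈ with ∈-comprehension⁻ on? v∈
  ... | t , i , eq = t , toℕ i , toℕ≤pred[n] i , eq

  union-step : ∀ t {i} → i < len t → Adj union (at t i) (at t (suc i))
  union-step t i< = t , fromℕ< i< , inj₁ (cong (at t) (toℕ-fromℕ< i<) , cong (at t ∘ suc) (toℕ-fromℕ< i<))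

  union⊆ : union ⊆ᴳ G
  union⊆ = record
    { V⊆   = λ v∈ → let t , i , i≤ , eq = union∈⁻ v∈ in subst (_∈ V G) eq (at∈V t i≤)
    ; Adj⊆ = joins⇒adj
    }
    where
    at∈V : ∀ t {i} → i ≤ len t → at t i ∈ V G
    at∈V t {zero}  _  = adj⇒∈ G (at-step t (len-pos t))
    at∈V t {suc i} i< = adj⇒∈ G (symm G (at-step t i<))

  union-walk : ∀ t {i j} → i ≤ j → j ≤ len t → Walk union (j ∸ i) (at t i) (at t j)
  union-walk t {i} i≤j j≤ = ladder-between (at t) i≤j (union∈⁺ t (≤-trans i≤j j≤))
                              (λ _ j< → union-step t (<-≤-trans j< j≤))

  -- `interior` compares an inner position with every position of every strand, ends included. It
  -- therefore yields at once that strands are injective, that they avoid the branch vertices, and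
  -- that they are internally disjoint. Only the two ends of one strand remain, and `lft≢rgt`
  -- separates them.
  module Subdivide {m} {X : Graph m} (branch : Fin m → Fin n)
    (branch-inj : ∀ {x y} → branch x ≡ branch y → x ≡ y)
    (index : Edge X → Fin q) (edge : Fin q → Edge X) (index-edge : ∀ t → index (edge t) ≡ t)
    (lft rgt : Fin q → Fin m) (lft≢rgt : ∀ t → lft t ≢ rgt t)
    (left≡ : ∀ e → proj₁ (left e) ≡ lft (index e)) (right≡ : ∀ e → proj₁ (right e) ≡ rgt (index e))
    (at-lft : ∀ t → at t 0 ≡ branch (lft t)) (at-rgt : ∀ t → at t (len t) ≡ branch (rgt t))
    (incident : ∀ x → ∃[ t ] (x ≡ lft t ⊎ x ≡ rgt t))
    (interior : ∀ t t′ {i i′} → 0 < i → i < len t → i′ ≤ len t′ → at t i ≡ at t′ i′ → t ≡ t′ × i ≡ i′)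
    where

    private
      branch-at : ∀ x → ∃[ t ] ∃[ i ] ((i ≡ 0 ⊎ i ≡ len t) × at t i ≡ branch x)
      branch-at x with incident x
      ... | t , inj₁ refl = t , 0 , inj₁ refl , at-lft t
      ... | t , inj₂ refl = t , len t , inj₂ refl , at-rgt t

      end≤ : ∀ t {i} → i ≡ 0 ⊎ i ≡ len t → i ≤ len t
      end≤ t (inj₁ refl) = z≤n
      end≤ t (inj₂ refl) = ≤-refl

      branch∈ : ∀ x → branch x ∈ V union
      branch∈ x with branch-at x
      ... | t , i , end , eq = subst (_∈ V union) eq (union∈⁺ t (end≤ t end))

      strand-inj : ∀ t {i j} → i < j → j ≤ len t → at t i ≢ at t j
      strand-inj t {suc i} i<j j≤ eq = <⇒≢ i<j (proj₂ (interior t t (s≤s z≤n) (<-≤-trans i<j j≤) j≤ eq))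
      strand-inj t {zero} {j} 0<j j≤ eq with m≤n⇒m<n∨m≡n j≤
      ... | inj₁ j<   = <⇒≢ 0<j (sym (proj₂ (interior t t 0<j j< z≤n (sym eq))))
      ... | inj₂ refl = lft≢rgt t (branch-inj (trans (sym (at-lft t)) (trans eq (at-rgt t))))

      strand : ∀ e → Path union (branch (proj₁ (left e))) (branch (proj₁ (right e))) (len (index e))
      strand e = functionPath union (len (index e)) (at (index e))
        (trans (cong branch (left≡ e)) (sym (at-lft (index e))))
        (trans (at-rgt (index e)) (cong branch (sym (right≡ e))))
        (union∈⁺ (index e)) (union-step (index e)) (strand-inj (index e))

      internal : ∀ t {i} → 0 < i → i < len t → Path.Internal (strand (edge t)) (at t i)
      internal t {i} 0<i i< with index (edge t) | index-edge t
      ... | .t | refl = fromℕ< (m<n⇒m<1+n i<) , subst (0 <_) (sym eq) 0<i , subst (_< len t) (sym eq) i< ,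
                        cong (at t) eq
        where eq = toℕ-fromℕ< (m<n⇒m<1+n i<)

      uses : ∀ t (i : Fin (len t)) → JoinedBy t (toℕ i) (suc (toℕ i)) u v →
             Path.Uses (strand (edge t)) u v
      uses {u} {v} t i j with index (edge t) | index-edge t
      ... | .t | refl = i , subst (λ k → JoinedBy t k (suc (toℕ i)) u v) (sym (toℕ-inject₁ i)) j

    subdivision : ∀ k → (∀ t → k + 1 ≤ len t) → Subdivision≥ k X union
    subdivision k len≥ = record
      { branch           = λ (x , _) → branch x , branch∈ x
      ; branch-injective = branch-inj
      ; len              = len ∘ index
      ; len≥             = len≥ ∘ index
      ; path             = strand
      ; avoids-branch    = avoids
      ; disjoint         = λ e f (i , 0<i , i< , eq) (j , 0<j , j< , eq′) →
          let same = proj₁ (interior (index e) (index f) 0<i i< (<⇒≤ j<) (trans eq (sym eq′)))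
          in trans (left≡ e) (trans (cong lft same) (sym (left≡ f))) ,
             trans (right≡ e) (trans (cong rgt same) (sym (right≡ f)))
      ; vertices-covered = λ w∈ → let t , i , i≤ , eq = union∈⁻ w∈ in cover t i i≤ eq
      ; edges-covered    = λ (t , i , j) → edge t , uses t i j
      }
      where
      avoids : ∀ e x → ¬ Path.Internal (strand e) (branch (proj₁ x))
      avoids e (x , _) (i , 0<i , i< , eq) with branch-at x
      ... | t , j , end , eq′ with interior (index e) t 0<i i< (end≤ t end) (trans eq (sym eq′))
      ...   | refl , refl = [ (λ i≡0 → <⇒≢ 0<i (sym i≡0)) , <⇒≢ i< ] end
      cover : ∀ t i {w} → i ≤ len t → at t i ≡ w →
              (∃[ x ] branch (proj₁ x) ≡ w) ⊎ (∃[ e ] Path.Internal (strand e) w)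
      cover t zero    _  refl = inj₁ (left (edge t) ,
        trans (cong branch (trans (left≡ (edge t)) (cong lft (index-edge t)))) (sym (at-lft t)))
      cover t (suc i) i≤ refl with m≤n⇒m<n∨m≡n i≤
      ... | inj₁ i<   = inj₂ (edge t , internal t (s≤s z≤n) i<)
      ... | inj₂ end  = inj₁ (right (edge t) ,
        trans (cong branch (trans (right≡ (edge t)) (cong rgt (index-edge t))))
              (trans (sym (at-rgt t)) (cong (at t) (sym end))))

-- Quasi-geodesic claws

n∸1+i<n : ∀ {n} i → 0 < n → n ∸ suc i < n
n∸1+i<n {suc n} i _ = s≤s (m∸n≤m n i)

-- The metric hypotheses speak of arbitrary walks of `G`. For shortest walks they say that the union
-- is 3-quasi-geodesic; for walks of length 0 they say that the legs are injective and meet only in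
-- the centre.
module Claw {n} (G : Graph n) (len : Fin 3 → ℕ) (at : Fin 3 → ℕ → Fin n)
            (len-pos : ∀ t → 0 < len t)
            (at-step : ∀ t {i} → i < len t → Adj G (at t i) (at t (suc i)))
            (centre : Fin n) (at-centre : ∀ t → at t 0 ≡ centre)
            (same-leg : ∀ t {i j e} → i ≤ len t → j ≤ len t → Walk G e (at t i) (at t j) → j ≤ i + e)
            (two-legs : ∀ {t t′ i j e} → t ≢ t′ → i ≤ len t → j ≤ len t′ →
                        Walk G e (at t i) (at t′ j) → i + j ≤ 3 * e) where

  open Union G len at len-pos at-step public

  private
    X : Graph 4
    X = completeBipartite 1 3

    edge-of : (e : Edge X) → ∃[ t ] (proj₁ (left e) ≡ zero × proj₁ (right e) ≡ suc t)
    edge-of record { left = x , _ ; right = zero , _ ; ordered = x<0 } = ⊥-elim-irr (n≮0 x<0)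
    edge-of record { left = x , _ ; right = suc t , _ ; ordered = x<t ; adjacent = adj } =
      t , recompute (x ≟ zero) (left-zero adj) , refl
      where
      left-zero : Adj X x (suc t) → x ≡ zero
      left-zero (inj₁ (x<1 , _)) = toℕ-injective (n<1⇒n≡0 x<1)
      left-zero (inj₂ (t<1 , _)) = ⊥-elim (n≮0 (s≤s⁻¹ t<1))

    edge : Fin 3 → Edge X
    edge t = record { left = zero , ∈⊤ ; right = suc t , ∈⊤ ; ordered = s≤s z≤n
                    ; adjacent = inj₁ (s≤s z≤n , s≤s z≤n) }

    branch : Fin 4 → Fin n
    branch zero    = centre
    branch (suc t) = at t (len t)

    still : ∀ t t′ {i j} → i ≤ len t → at t i ≡ at t′ j → Walk G 0 (at t i) (at t′ j)
    still t t′ {i} i≤ eq = subst (Walk G 0 (at t i)) eq (nil (_⊆ᴳ_.V⊆ union⊆ (union∈⁺ t i≤)))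

    -- The tip `i = len t` is included, so that the same argument separates the branch vertices.
    interior : ∀ t t′ {i j} → 0 < i → i ≤ len t → j ≤ len t′ → at t i ≡ at t′ j → t ≡ t′ × i ≡ j
    interior t t′ {i} {j} 0<i i≤ j≤ eq with t ≟ t′
    ... | yes refl = refl , ≤-antisym
      (≤-trans (same-leg t j≤ i≤ (reverse (still t t i≤ eq))) (≤-reflexive (+-identityʳ j)))
      (≤-trans (same-leg t i≤ j≤ (still t t i≤ eq)) (≤-reflexive (+-identityʳ i)))
    ... | no t≢t′ = ⊥-elim (<⇒≱ 0<i (≤-trans (m≤m+n i j) (two-legs t≢t′ i≤ j≤ (still t t′ i≤ eq))))

    centre≢tip : ∀ t → centre ≢ at t (len t)
    centre≢tip t eq =
      <⇒≢ (len-pos t) (sym (proj₂ (interior t t (len-pos t) ≤-refl z≤n (trans (sym eq) (sym (at-centre t))))))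

    branch-inj : ∀ {x y} → branch x ≡ branch y → x ≡ y
    branch-inj {zero}  {zero}  _  = refl
    branch-inj {zero}  {suc t} eq = ⊥-elim (centre≢tip t eq)
    branch-inj {suc t} {zero}  eq = ⊥-elim (centre≢tip t (sym eq))
    branch-inj {suc t} {suc t′} eq = cong suc (proj₁ (interior t t′ (len-pos t) ≤-refl ≤-refl eq))

    lft rgt : Fin 3 → Fin 4
    lft _ = zero
    rgt   = suc

    centre≢end : ∀ t → lft t ≢ rgt t
    centre≢end t ()

    incident : ∀ x → ∃[ t ] (x ≡ lft t ⊎ x ≡ rgt t)
    incident zero    = zero , inj₁ refl
    incident (suc t) = t , inj₂ refl

  claw : ∀ k → (∀ t → k + 1 ≤ len t) → Subdivision≥ k (completeBipartite 1 3) union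
  claw = S.subdivision
    where
    module S = Subdivide {X = X} branch branch-inj (λ e → proj₁ (edge-of e)) edge (λ _ → refl)
                         lft rgt centre≢end
                         (λ e → proj₁ (proj₂ (edge-of e))) (λ e → proj₂ (proj₂ (edge-of e)))
                         at-centre (λ _ → refl) incident
                         (λ t t′ 0<i i< → interior t t′ 0<i (<⇒≤ i<))

  quasi-geodesic : QuasiGeodesic 3 union G
  quasi-geodesic u∈ v∈ dist with union∈⁻ u∈ | union∈⁻ v∈
  ... | t , i , i≤ , refl | t′ , j , j≤ , refl with t ≟ t′
  ...   | no t≢t′ = walk⇒dist≤ (reverse (union-walk t z≤n i≤) ++
                                subst (λ c → Walk union j c (at t′ j)) (trans (at-centre t′) (sym (at-centre t)))
                                      (union-walk t′ z≤n j≤))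
                               (two-legs t≢t′ i≤ j≤ (dist⇒walk dist))
  ...   | yes refl with ≤-total i j
  ...     | inj₁ i≤j = walk⇒dist≤ (union-walk t i≤j j≤)
      (≤-trans (m≤n+o⇒m∸n≤o j i (same-leg t i≤ j≤ (dist⇒walk dist))) (m≤n*m _ 3))
  ...     | inj₂ j≤i = walk⇒dist≤ (reverse (union-walk t j≤i i≤))
      (≤-trans (m≤n+o⇒m∸n≤o i j (same-leg t j≤ i≤ (reverse (dist⇒walk dist)))) (m≤n*m _ 3))

-- Geodesic cycles from odd closed walks

xor-≢ : ∀ x y → x ≢ y → x xor y ≡ true
xor-≢ true  true  x≢y = ⊥-elim (x≢y refl)
xor-≢ true  false _   = refl
xor-≢ false true  _   = refl
xor-≢ false false x≢y = ⊥-elim (x≢y refl)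

-- For the homomorphism from walks to ℤ/2 given by ω, replacing one of the two arcs of a
-- closed odd walk by a shortcut W gives two closed walks, one of which is odd; so a shortest
-- closed odd walk is a geodesic cycle.
module OddCycle {n} (G : Graph n) (ω : Fin n → Fin n → Bool) (ω-sym : ∀ x y → ω x y ≡ ω y x)
                {m s} (C : Walk G m s s) (odd : parity ω C ≡ true)
                (shortest : ∀ {e x} (W : Walk G e x x) → parity ω W ≡ true → m ≤ e)
                (k r : ℕ) (m≡ : suc k + suc k + r ≡ m) (k<r : suc k ≤ r) where

  private
    K : ℕ
    K = suc k

    γ : ℕ → Fin n
    γ = C ‼_

    γ-closed : γ m ≡ γ 0
    γ-closed = at-target C

    -- The arc from `γ i` to `γ (i + d)` has length `d` and its complement `m - d`, so the
    -- alternatives say that one of the two arcs is no longer than `W`. The parity of `W` decides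
    -- which one.
    shortcut : i + d ≤ m → Walk G e (γ i) (γ (i + d)) → d ≤ e ⊎ m ≤ e + d
    shortcut {i} {d} {e} i+d≤ W with segments C i+d≤ ω
    ... | record { rest = r ; length≡ = length≡ ; before = T ; middle = M ; after = R ; parity≡ = parity≡ }
      with parity ω W Bool.≟ parity ω M
    ...   | yes eq = inj₁ (linear 0 (shortest (T ++ W ++ R) closed-odd) (identity i d e r length≡))
      where
      closed-odd : parity ω (T ++ W ++ R) ≡ true
      closed-odd = begin
        parity ω (T ++ W ++ R)                         ≡⟨ parity-++ ω T (W ++ R) ⟩
        parity ω T xor parity ω (W ++ R)               ≡⟨ cong (parity ω T xor_) (parity-++ ω W R) ⟩
        parity ω T xor (parity ω W xor parity ω R)     ≡⟨ cong (λ b → parity ω T xor (b xor parity ω R)) eq ⟩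
        parity ω T xor (parity ω M xor parity ω R)     ≡⟨ parity≡ ⟨
        parity ω C                                     ≡⟨ odd ⟩
        true                                           ∎
        where open ≡-Reasoning
      identity : ∀ i d e r → i + d + r ≡ m → d + (i + (e + r)) + 0 ≡ e + m
      identity i d e r refl = solver i d e r
        where
        solver : ∀ i d e r → d + (i + (e + r)) + 0 ≡ e + (i + d + r)
        solver = solve-∀
    ...   | no neq = inj₂ (shortest (W ++ reverse M)
      (trans (parity-++ ω W (reverse M))
        (trans (cong (parity ω W xor_) (parity-reverse ω ω-sym M)) (xor-≢ _ _ neq))))

    γ∈ : ∀ i → γ i ∈ V G
    γ∈ = at∈ C

    -- A coincidence of vertices is a shortcut of length 0, so one of the two arcs between them is
    -- empty.
    γ-inj′ : i < j → j ≤ m → γ i ≡ γ j → i ≡ 0 × j ≡ m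
    γ-inj′ {i} {j} i<j j≤ eq with shortcut {i} {j ∸ i} (≤-trans (≤-reflexive i+d≡j) j≤)
                                   (subst (Walk G 0 (γ i)) (trans eq (cong γ (sym i+d≡j))) (nil (γ∈ i)))
      where
      i+d≡j : i + (j ∸ i) ≡ j
      i+d≡j = m+[n∸m]≡n (<⇒≤ i<j)
    ... | inj₁ d≤0 = ⊥-elim (<⇒≱ (m<n⇒0<n∸m i<j) d≤0)
    ... | inj₂ m≤d = i≡0 i j i<j (≤-trans j≤ m≤d) , ≤-antisym j≤ (≤-trans m≤d (m∸n≤m j i))
      where
      i≡0 : ∀ i j → i < j → j ≤ j ∸ i → i ≡ 0
      i≡0 zero    _       _ _  = refl
      i≡0 (suc i) (suc j) _ le = ⊥-elim (<⇒≱ (s≤s (m∸n≤m j i)) le)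

    γ-inj : 0 < i → i < m → j ≤ m → γ i ≡ γ j → i ≡ j
    γ-inj {i} {j} 0<i i<m j≤m eq with <-cmp i j
    ... | tri< i<j _ _ = ⊥-elim (<⇒≢ 0<i (sym (proj₁ (γ-inj′ i<j j≤m eq))))
    ... | tri≈ _ i≡j _ = i≡j
    ... | tri> _ _ j<i = ⊥-elim (<⇒≢ i<m (proj₂ (γ-inj′ j<i (<⇒≤ i<m) (sym eq))))

    γ-inj₀ : i < m → j < m → γ i ≡ γ j → i ≡ j
    γ-inj₀ {i} {j} i<m j<m eq with <-cmp i j
    ... | tri< i<j _ _ = ⊥-elim (<⇒≢ j<m (proj₂ (γ-inj′ i<j (<⇒≤ j<m) eq)))
    ... | tri≈ _ i≡j _ = i≡j
    ... | tri> _ _ j<i = ⊥-elim (<⇒≢ i<m (proj₂ (γ-inj′ j<i (<⇒≤ i<m) (sym eq))))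

    K+K+≤ : i ≤ r → K + K + i ≤ m
    K+K+≤ i≤ = ≤-trans (+-monoʳ-≤ (K + K) i≤) (≤-reflexive m≡)

    K+K+< : i < r → K + K + i < m
    K+K+< i< = <-≤-trans (+-monoʳ-< (K + K) i<) (≤-reflexive m≡)

    0<r : 0 < r
    0<r = ≤-trans (s≤s z≤n) k<r

    K+K<m : K + K < m
    K+K<m = ≤-<-trans (≤-reflexive (sym (+-identityʳ (K + K)))) (K+K+< 0<r)

    len : Fin 3 → ℕ
    len zero             = K
    len (suc zero)       = r
    len (suc (suc zero)) = K

    -- The corners of the triangle are at 0, `K` and `K + K`. An `Edge` runs from its smaller to its
    -- larger end, so the strand from corner 0 to corner 2 traverses the last arc backwards,
    -- starting at position `m`, where the closed walk is back at corner 0.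
    pos : Fin 3 → ℕ → ℕ
    pos zero             i = i
    pos (suc zero)       i = K + K + (r ∸ i)
    pos (suc (suc zero)) i = K + i

    at : Fin 3 → ℕ → Fin n
    at t i = γ (pos t i)

    pos≤ : ∀ t {i} → i ≤ len t → pos t i ≤ m
    pos≤ zero             i≤     = ≤-trans i≤ (≤-trans (m≤m+n K K) (<⇒≤ K+K<m))
    pos≤ (suc zero)       {i} _  = K+K+≤ (m∸n≤m r i)
    pos≤ (suc (suc zero)) i≤     = ≤-trans (+-monoʳ-≤ K i≤) (<⇒≤ K+K<m)

    pos-pos : ∀ t {i} → 0 < i → 0 < pos t i
    pos-pos zero             0<i = 0<i
    pos-pos (suc zero)       _   = s≤s z≤n
    pos-pos (suc (suc zero)) _   = s≤s z≤n

    pos<m : ∀ t {i} → 0 < i → i < len t → pos t i < m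
    pos<m zero             _ i< = <-trans i< (≤-<-trans (m≤m+n K K) K+K<m)
    pos<m (suc zero)       {suc i} _ _ = K+K+< (n∸1+i<n i 0<r)
    pos<m (suc (suc zero)) _ i< = <-trans (+-monoʳ-< K i<) K+K<m

    pos-inj : ∀ t t′ {i j} → 0 < i → i < len t → j ≤ len t′ → pos t i ≡ pos t′ j → t ≡ t′ × i ≡ j
    pos-inj zero zero _ _ _ eq = refl , eq
    pos-inj zero (suc zero) _ i< _ eq =
      ⊥-elim (<⇒≱ i< (≤-trans (≤-trans (m≤m+n K K) (m≤m+n (K + K) _)) (≤-reflexive (sym eq))))
    pos-inj zero (suc (suc zero)) _ i< _ eq = ⊥-elim (<⇒≱ i< (≤-trans (m≤m+n K _) (≤-reflexive (sym eq))))
    pos-inj (suc zero) zero {i} {j} _ i< j≤ eq =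
      ⊥-elim (<⇒≱ (<-≤-trans (K+K<pos i<) (≤-reflexive eq)) (≤-trans j≤ (m≤m+n K K)))
      where
      K+K<pos : i < r → K + K < K + K + (r ∸ i)
      K+K<pos i< = m<m+n (K + K) (m<n⇒0<n∸m i<)
    pos-inj (suc zero) (suc zero) _ i< j≤ eq = refl , ∸-cancelˡ-≡ (<⇒≤ i<) j≤ (+-cancelˡ-≡ (K + K) _ _ eq)
    pos-inj (suc zero) (suc (suc zero)) _ i< j≤ eq =
      ⊥-elim (<⇒≱ (<-≤-trans (m<m+n (K + K) (m<n⇒0<n∸m i<)) (≤-reflexive eq)) (+-monoʳ-≤ K j≤))
    pos-inj (suc (suc zero)) zero 0<i _ j≤ eq = ⊥-elim (<⇒≱ (<-≤-trans (m<m+n K 0<i) (≤-reflexive eq)) j≤)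
    pos-inj (suc (suc zero)) (suc zero) _ i< _ eq =
      ⊥-elim (<⇒≱ (+-monoʳ-< K i<) (≤-trans (m≤m+n (K + K) _) (≤-reflexive (sym eq))))
    pos-inj (suc (suc zero)) (suc (suc zero)) _ _ _ eq = refl , +-cancelˡ-≡ K _ _ eq

    γ-step : i < m → Adj G (γ i) (γ (suc i))
    γ-step = at-step C

    len-pos : ∀ t → 0 < len t
    len-pos zero             = s≤s z≤n
    len-pos (suc zero)       = 0<r
    len-pos (suc (suc zero)) = s≤s z≤n

    pos-back : i < r → suc (pos (suc zero) (suc i)) ≡ pos (suc zero) i
    pos-back {i} i< = trans (sym (+-suc (K + K) (r ∸ suc i))) (cong (K + K +_) (sym (+-∸-assoc 1 i<)))

    strand-step : ∀ t {i} → i < len t → Adj G (at t i) (at t (suc i))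
    strand-step zero             i<     = γ-step (<-trans i< (≤-<-trans (m≤m+n K K) K+K<m))
    strand-step (suc zero)       {i} i< =
      symm G (subst (λ j → Adj G (at (suc zero) (suc i)) (γ j)) (pos-back i<)
                    (γ-step (K+K+< (n∸1+i<n i 0<r))))
    strand-step (suc (suc zero)) {i} i< =
      subst (λ j → Adj G (γ (K + i)) (γ j)) (sym (+-suc K i)) (γ-step (<-trans (+-monoʳ-< K i<) K+K<m))

  open Union G len at len-pos strand-step public

  private
    X : Graph 3
    X = completeGraph 3

    lft rgt : Fin 3 → Fin 3
    lft zero             = zero
    lft (suc zero)       = zero
    lft (suc (suc zero)) = suc zero
    rgt zero             = suc zero
    rgt (suc zero)       = suc (suc zero)
    rgt (suc (suc zero)) = suc (suc zero)

    lft<rgt : ∀ t → lft t Fin.< rgt t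
    lft<rgt zero             = s≤s z≤n
    lft<rgt (suc zero)       = s≤s z≤n
    lft<rgt (suc (suc zero)) = s≤s (s≤s z≤n)

    lft≢rgt : ∀ t → lft t ≢ rgt t
    lft≢rgt t eq = <⇒≢ (lft<rgt t) (cong toℕ eq)

    edge-between : ∀ x y → .(x Fin.< y) → ∃[ t ] (x ≡ lft t × y ≡ rgt t)
    edge-between zero zero lt = ⊥-elim-irr (n≮n 0 lt)
    edge-between zero (suc zero) _ = zero , refl , refl
    edge-between zero (suc (suc zero)) _ = suc zero , refl , refl
    edge-between (suc x) zero lt = ⊥-elim-irr (n≮0 lt)
    edge-between (suc zero) (suc zero) lt = ⊥-elim-irr (n≮n 1 lt)
    edge-between (suc zero) (suc (suc zero)) _ = suc (suc zero) , refl , refl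
    edge-between (suc (suc zero)) (suc zero) lt = ⊥-elim-irr (n≮0 (s≤s⁻¹ lt))
    edge-between (suc (suc zero)) (suc (suc zero)) lt = ⊥-elim-irr (n≮n 2 lt)

    edge-of : (e : Edge X) → ∃[ t ] (proj₁ (left e) ≡ lft t × proj₁ (right e) ≡ rgt t)
    edge-of record { left = x , _ ; right = y , _ ; ordered = x<y } = edge-between x y x<y

    edge : Fin 3 → Edge X
    edge t = record { left = lft t , ∈⊤ ; right = rgt t , ∈⊤ ; ordered = lft<rgt t ; adjacent = lft≢rgt t }

    edge-of-edge : ∀ t → proj₁ (edge-of (edge t)) ≡ t
    edge-of-edge zero             = refl
    edge-of-edge (suc zero)       = refl
    edge-of-edge (suc (suc zero)) = refl

    corner : Fin 3 → ℕ
    corner zero             = 0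
    corner (suc zero)       = K
    corner (suc (suc zero)) = K + K

    corner<m : ∀ x → corner x < m
    corner<m zero             = ≤-<-trans z≤n K+K<m
    corner<m (suc zero)       = ≤-<-trans (m≤m+n K K) K+K<m
    corner<m (suc (suc zero)) = K+K<m

    corner-inj : ∀ x y → corner x ≡ corner y → x ≡ y
    corner-inj zero zero _ = refl
    corner-inj zero (suc zero) ()
    corner-inj zero (suc (suc zero)) ()
    corner-inj (suc zero) zero ()
    corner-inj (suc zero) (suc zero) _ = refl
    corner-inj (suc zero) (suc (suc zero)) eq = ⊥-elim (<⇒≢ (m<m+n K (s≤s z≤n)) eq)
    corner-inj (suc (suc zero)) zero ()
    corner-inj (suc (suc zero)) (suc zero) eq = ⊥-elim (<⇒≢ (m<m+n K (s≤s z≤n)) (sym eq))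
    corner-inj (suc (suc zero)) (suc (suc zero)) _ = refl

    branch-inj : ∀ {x y} → γ (corner x) ≡ γ (corner y) → x ≡ y
    branch-inj {x} {y} eq = corner-inj x y (γ-inj₀ (corner<m x) (corner<m y) eq)

    at-lft : ∀ t → at t 0 ≡ γ (corner (lft t))
    at-lft zero             = refl
    at-lft (suc zero)       = trans (cong γ m≡) γ-closed
    at-lft (suc (suc zero)) = cong γ (+-identityʳ K)

    at-rgt : ∀ t → at t (len t) ≡ γ (corner (rgt t))
    at-rgt zero             = refl
    at-rgt (suc zero)       = cong γ (trans (cong (K + K +_) (n∸n≡0 r)) (+-identityʳ (K + K)))
    at-rgt (suc (suc zero)) = refl

    incident : ∀ x → ∃[ t ] (x ≡ lft t ⊎ x ≡ rgt t)
    incident zero             = zero , inj₁ refl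
    incident (suc zero)       = zero , inj₂ refl
    incident (suc (suc zero)) = suc zero , inj₂ refl

    interior : ∀ t t′ {i j} → 0 < i → i < len t → j ≤ len t′ → at t i ≡ at t′ j → t ≡ t′ × i ≡ j
    interior t t′ 0<i i< j≤ eq =
      pos-inj t t′ 0<i i< j≤ (γ-inj (pos-pos t 0<i) (pos<m t 0<i i<) (pos≤ t′ j≤) eq)

    len≥ : ∀ t → k + 1 ≤ len t
    len≥ zero             = ≤-reflexive (+-comm k 1)
    len≥ (suc zero)       = ≤-trans (≤-reflexive (+-comm k 1)) k<r
    len≥ (suc (suc zero)) = ≤-reflexive (+-comm k 1)

  triangle : Subdivision≥ k (completeGraph 3) union
  triangle = S.subdivision k len≥
    where
    module S = Subdivide {X = X} (γ ∘ corner) branch-inj (λ e → proj₁ (edge-of e)) edge edge-of-edge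
                         lft rgt lft≢rgt (λ e → proj₁ (proj₂ (edge-of e))) (λ e → proj₂ (proj₂ (edge-of e)))
                         at-lft at-rgt incident interior

  private
    cycle-step : i < m → Adj union (γ i) (γ (suc i))
    cycle-step {i} i<m with i <? K
    ... | yes i<K = union-step zero i<K
    ... | no i≮K with i <? K + K
    ...   | yes i<K+K = subst (λ j → Adj union (γ j) (γ (suc j))) K+≡i
                          (subst (λ j → Adj union (γ (K + (i ∸ K))) (γ j)) (+-suc K (i ∸ K))
                            (union-step (suc (suc zero))
                              (+-cancelˡ-< K _ _ (≤-<-trans (≤-reflexive K+≡i) i<K+K))))
      where
      K+≡i : K + (i ∸ K) ≡ i
      K+≡i = m+[n∸m]≡n (≮⇒≥ i≮K)
    ...   | no i≮K+K = symm union (subst₂ (λ j j′ → Adj union (γ j) (γ j′))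
                                    (trans (sym (pos-back q<r)) (cong suc back≡i)) back≡i
                                    (union-step (suc zero) q<r))
      where
      -- On the reversed strand, position `suc q` lies over `i` and position `q` over `suc i`.
      q = r ∸ suc (i ∸ (K + K))
      K+K+≡i : K + K + (i ∸ (K + K)) ≡ i
      K+K+≡i = m+[n∸m]≡n (≮⇒≥ i≮K+K)
      i∸<r : i ∸ (K + K) < r
      i∸<r = +-cancelˡ-< (K + K) _ _ (<-≤-trans (≤-<-trans (≤-reflexive K+K+≡i) i<m) (≤-reflexive (sym m≡)))
      q<r : q < r
      q<r = n∸1+i<n (i ∸ (K + K)) 0<r
      back≡i : pos (suc zero) (suc q) ≡ i
      back≡i = trans (cong (λ j → K + K + (r ∸ j)) (sym (+-∸-assoc 1 i∸<r)))
                 (trans (cong (K + K +_) (m∸[m∸n]≡n (<⇒≤ i∸<r))) K+K+≡i)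

    arc : i ≤ j → j ≤ m → γ i ∈ V union → Walk union (j ∸ i) (γ i) (γ j)
    arc i≤j j≤m i∈ = ladder-between γ i≤j i∈ (λ _ l< → cycle-step (<-≤-trans l< j≤m))

    geodesic-arc : i ≤ j → j ≤ m → γ i ∈ V union → γ j ∈ V union → Walk G e (γ i) (γ j) →
                   ∃[ d ] (d ≤ e × Walk union d (γ i) (γ j))
    geodesic-arc {i} {j} {e} i≤j j≤m i∈ j∈ W
      with shortcut {i} {j ∸ i} (≤-trans (≤-reflexive i+d≡j) j≤m)
                    (subst (λ x → Walk G e (γ i) (γ x)) (sym i+d≡j) W)
      where
      i+d≡j : i + (j ∸ i) ≡ j
      i+d≡j = m+[n∸m]≡n i≤j
    ... | inj₁ d≤e = j ∸ i , d≤e , arc i≤j j≤m i∈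
    -- The complementary arc runs through the base vertex, which is both `γ 0` and `γ m`.
    ... | inj₂ m≤e+d = i + (m ∸ j) , arithmetic (m+[n∸m]≡n i≤j) (m+[n∸m]≡n j≤m) m≤e+d ,
        reverse (arc z≤n (≤-trans i≤j j≤m) 0∈) ++
        subst (λ x → Walk union (m ∸ j) x (γ j)) γ-closed (reverse (arc j≤m ≤-refl j∈))
      where
      0∈ : γ 0 ∈ V union
      0∈ = union∈⁺ zero z≤n
      arithmetic : ∀ {d r} → i + d ≡ j → j + r ≡ m → m ≤ e + d → i + r ≤ e
      arithmetic {d} {r} refl refl le = linear 0 le (identity i d r e)
        where
        identity : ∀ i d r e → i + r + (e + d) + 0 ≡ e + (i + d + r)
        identity = solve-∀

  geodesic : Geodesic union G
  geodesic u∈ v∈ {d} dist with union∈⁻ u∈ | union∈⁻ v∈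
  ... | t , i , i≤ , refl | t′ , j , j≤ , refl with ≤-total (pos t i) (pos t′ j)
  ...   | inj₁ le with geodesic-arc le (pos≤ t′ j≤) u∈ v∈ (dist⇒walk dist)
  ...     | _ , e≤ , X = walk⇒dist≤ X (≤-trans e≤ (≤-reflexive (sym (*-identityˡ d))))
  geodesic u∈ v∈ {d} dist | t , i , i≤ , refl | t′ , j , j≤ , refl | inj₂ ge
    with geodesic-arc ge (pos≤ t i≤) v∈ u∈ (reverse (dist⇒walk dist))
  ...     | _ , e≤ , X = walk⇒dist≤ (reverse X) (≤-trans e≤ (≤-reflexive (sym (*-identityˡ d))))

-- Every vertex is close to a diametral path

-- Origin of the factor 3. Let a walk of length `e` join the vertex at distance `a` from the centre
-- along P to the vertex at distance `b` on the third leg. That vertex has distance `b` from all of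
-- P, so `b ≤ e`, and the triangle inequality gives `a ≤ e + b`.
leg-sum : ∀ {a b e} → a ≤ e + b → b ≤ e → a + b ≤ 3 * e
leg-sum {a} {b} {e} p q = linear 0 (p ⊕ q ⊕ q) (identity a b e)
  where
  identity : ∀ a b e → a + b + (e + b + (e + e)) + 0 ≡ 3 * e + (a + (b + b))
  identity = solve-∀

∧-true : ∀ a b → a ∧ b ≡ true → a ≡ true × b ≡ true
∧-true true true _ = refl , refl

xor-true : ∀ a b → a xor b ≡ true → (a ≡ true × b ≡ false) ⊎ (a ≡ false × b ≡ true)
xor-true true  false _ = inj₁ (refl , refl)
xor-true false true  _ = inj₂ (refl , refl)

xor-false : ∀ a b → a xor b ≡ false → a ≡ b
xor-false false false _ = refl
xor-false true  true  _ = refl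

module Diametral {n} (k : ℕ) (G : Graph n) (G-connected : Connected G)
  (no-cycle : ¬ (∃[ Y ] (Y ⊆ᴳ G × Subdivision≥ k (completeGraph 3) Y × Geodesic Y G)))
  (no-claw  : ¬ (∃[ Y ] (Y ⊆ᴳ G × Subdivision≥ (3 * k) (completeBipartite 1 3) Y × QuasiGeodesic 3 Y G)))
  {ℓ s t} (W : Walk G ℓ s t) (W-shortest : ∀ {e} → Walk G e s t → ℓ ≤ e)
  (diameter : ∀ {u v} → u ∈ V G → v ∈ V G → Metric.δ G G-connected u v ≤ ℓ)
  (long : 18 * k + 3 ≤ ℓ) where

  open Metric G G-connected
  open Projection W W-shortest

  private
    Far : Fin n → Set
    Far x = 3 * k + 1 ≤ h x

    far? : ∀ x → Dec (Far x)
    far? x = 3 * k + 1 ≤? h x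

    near : ∀ x → ¬ Far x → h x ≤ 3 * k
    near x ¬far = s≤s⁻¹ (<-≤-trans (≰⇒> ¬far) (≤-reflexive (+-comm _ 1)))

  module _ {x i} (i≤ℓ : i ≤ ℓ) (X : Walk G (h x) x (p i)) where
    private
      Q : Walk G (h x) (p i) x
      Q = reverse X

      legs : Fin 3 → ℕ
      legs zero             = i
      legs (suc zero)       = ℓ ∸ i
      legs (suc (suc zero)) = h x

      at : Fin 3 → ℕ → Fin n
      at zero             j = p (i ∸ j)
      at (suc zero)       j = p (i + j)
      at (suc (suc zero)) j = Q ‼ j

      low≤ : ∀ j → i ∸ j ≤ ℓ
      low≤ j = ≤-trans (m∸n≤m i j) i≤ℓ

      high≤ : j ≤ ℓ ∸ i → i + j ≤ ℓ
      high≤ j≤ = ≤-trans (+-monoʳ-≤ i j≤) (≤-reflexive (m+[n∸m]≡n i≤ℓ))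

      high< : j < ℓ ∸ i → i + j < ℓ
      high< j< = <-≤-trans (+-monoʳ-< i j<) (≤-reflexive (m+[n∸m]≡n i≤ℓ))

      at-step′ : ∀ t {j} → j < legs t → Adj G (at t j) (at t (suc j))
      at-step′ zero {j} j< = symm G (subst (λ l → Adj G (p (i ∸ suc j)) (p l)) (sym (+-∸-assoc 1 j<))
                               (p-step (<-≤-trans (n∸1+i<n j (≤-<-trans z≤n j<)) i≤ℓ)))
      at-step′ (suc zero) {j} j< = subst (λ l → Adj G (p (i + j)) (p l)) (sym (+-suc i j)) (p-step (high< j<))
      at-step′ (suc (suc zero)) j< = at-step Q j<

      at-centre : ∀ t → at t 0 ≡ p i
      at-centre zero             = refl
      at-centre (suc zero)       = cong p (+-identityʳ i)
      at-centre (suc (suc zero)) = refl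

      Q-before : j ≤ h x → Walk G j (p i) (Q ‼ j)
      Q-before = prefix Q

      -- Otherwise the rest of `Q` would bring `x` closer to P than its height.
      Q-height : j ≤ h x → a ≤ ℓ → Walk G e (Q ‼ j) (p a) → j ≤ e
      Q-height {j} {a} {e} j≤ a≤ Y = linear 0
        (≤-trans (h-min {x = x} a≤) (δ-min (reverse (suffix Q j≤) ++ Y)) ⊕ ≤-reflexive (m+[n∸m]≡n j≤))
        (identity j e (h x) (h x ∸ j))
        where
        identity : ∀ j e h r → j + (r + e + h) + 0 ≡ e + (h + (j + r))
        identity = solve-∀

      same-leg : ∀ t {a b e} → a ≤ legs t → b ≤ legs t → Walk G e (at t a) (at t b) → b ≤ a + e
      same-leg zero {a} {b} {e} a≤ b≤ Y =
        linear 0 (p-geodesic (low≤ b) (low≤ a) (reverse Y) ⊕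
                  ≤-reflexive (trans (m∸n+n≡m b≤) (sym (m∸n+n≡m a≤))))
               (identity (i ∸ a) (i ∸ b) a b e)
        where
        identity : ∀ A B a b e → b + (B + e + (A + a)) + 0 ≡ a + e + (A + (B + b))
        identity = solve-∀
      same-leg (suc zero) {a} {b} {e} a≤ b≤ Y =
        +-cancelˡ-≤ i _ _ (≤-trans (p-geodesic (high≤ a≤) (high≤ b≤) Y) (≤-reflexive (+-assoc i a e)))
      same-leg (suc (suc zero)) {a} {b} {e} a≤ b≤ Y =
        ≤-trans (Q-height b≤ i≤ℓ (reverse Y ++ reverse (Q-before a≤))) (≤-reflexive (+-comm e a))

      low-high : a ≤ i → b ≤ ℓ ∸ i → Walk G e (p (i ∸ a)) (p (i + b)) → a + b ≤ 3 * e
      low-high {a} {b} {e} a≤ b≤ Y =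
        linear (2 * e) (p-geodesic (low≤ a) (high≤ b≤) Y ⊕ ≤-reflexive (m∸n+n≡m a≤))
               (identity (i ∸ a) a b e i)
        where
        identity : ∀ A a b e i → a + b + (A + e + i) + 2 * e ≡ 3 * e + (i + b + (A + a))
        identity = solve-∀

      low-Q : a ≤ i → b ≤ h x → Walk G e (p (i ∸ a)) (Q ‼ b) → a + b ≤ 3 * e
      low-Q {a} {b} {e} a≤ b≤ Y = leg-sum
        (linear 0 (p-geodesic (low≤ a) i≤ℓ (Y ++ reverse (Q-before b≤)) ⊕ ≤-reflexive (m∸n+n≡m a≤))
                (identity (i ∸ a) a b e i))
        (Q-height b≤ (low≤ a) (reverse Y))
        where
        identity : ∀ A a b e i → a + (A + (e + b) + i) + 0 ≡ e + b + (i + (A + a))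
        identity = solve-∀

      high-Q : a ≤ ℓ ∸ i → b ≤ h x → Walk G e (p (i + a)) (Q ‼ b) → a + b ≤ 3 * e
      high-Q {a} {b} {e} a≤ b≤ Y = leg-sum
        (≤-trans (+-cancelˡ-≤ i _ _ (p-geodesic i≤ℓ (high≤ a≤) (Q-before b≤ ++ reverse Y)))
                 (≤-reflexive (+-comm b e)))
        (Q-height b≤ (high≤ a≤) (reverse Y))

      two-legs : ∀ {t t′ a b e} → t ≢ t′ → a ≤ legs t → b ≤ legs t′ →
                 Walk G e (at t a) (at t′ b) → a + b ≤ 3 * e
      two-legs {zero}           {zero}           t≢ = ⊥-elim (t≢ refl)
      two-legs {zero}           {suc zero}       _ a≤ b≤ Y = low-high a≤ b≤ Y
      two-legs {zero}           {suc (suc zero)} _ a≤ b≤ Y = low-Q a≤ b≤ Y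
      two-legs {suc zero}       {suc zero}       t≢ = ⊥-elim (t≢ refl)
      two-legs {suc zero}       {suc (suc zero)} _ a≤ b≤ Y = high-Q a≤ b≤ Y
      two-legs {suc (suc zero)} {suc (suc zero)} t≢ = ⊥-elim (t≢ refl)
      two-legs {suc zero}       {zero}     {a} _ a≤ b≤ Y =
        ≤-trans (≤-reflexive (+-comm a _)) (low-high b≤ a≤ (reverse Y))
      two-legs {suc (suc zero)} {zero}     {a} _ a≤ b≤ Y =
        ≤-trans (≤-reflexive (+-comm a _)) (low-Q b≤ a≤ (reverse Y))
      two-legs {suc (suc zero)} {suc zero} {a} _ a≤ b≤ Y =
        ≤-trans (≤-reflexive (+-comm a _)) (high-Q b≤ a≤ (reverse Y))

      no-three-long-legs : ¬ (∀ t → 3 * k + 1 ≤ legs t)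
      no-three-long-legs legs≥ = no-claw (C.union , C.union⊆ , C.claw (3 * k) legs≥ , C.quasi-geodesic)
        where
        module C = Claw G legs at (λ t → ≤-trans (m≤n+m 1 (3 * k)) (legs≥ t)) at-step′
                        (p i) at-centre same-leg two-legs

    nearest-to-far : Far x → i ≤ 3 * k ⊎ ℓ ≤ i + 3 * k
    nearest-to-far far with i ≤? 3 * k | ℓ ≤? i + 3 * k
    ... | yes i≤ | _      = inj₁ i≤
    ... | no _   | yes ℓ≤ = inj₂ ℓ≤
    ... | no i≰  | no ℓ≰  = ⊥-elim (no-three-long-legs legs≥)
      where
      legs≥ : ∀ t → 3 * k + 1 ≤ legs t
      legs≥ zero             = ≤-trans (≤-reflexive (+-comm _ 1)) (≰⇒> i≰)
      legs≥ (suc zero)       = +-cancelˡ-≤ i _ _ (≤-trans (≤-reflexive (trans (cong (i +_) (+-comm _ 1)) (+-suc i _)))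
                                 (≤-trans (≰⇒> ℓ≰) (≤-reflexive (sym (m+[n∸m]≡n i≤ℓ)))))
      legs≥ (suc (suc zero)) = far

  private
    left? : Fin n → Bool
    left? x = does (π x ≤? 3 * k)

    -- The indicator of crossing edges. For a far vertex `left?` tells to which end it projects. A
    -- near vertex may project anywhere, so its edges get weight 0, and P itself is free of crossing
    -- edges.
    ω : Fin n → Fin n → Bool
    ω x y = (does (far? x) ∧ does (far? y)) ∧ (left? x xor left? y)

    ω-sym : ∀ x y → ω x y ≡ ω y x
    ω-sym x y = cong₂ _∧_ (∧-comm (does (far? x)) (does (far? y))) (xor-comm (left? x) (left? y))

    ω-near : ∀ x y → ¬ Far x → ω x y ≡ false
    ω-near x y ¬far = cong (λ b → (b ∧ does (far? y)) ∧ (left? x xor left? y)) (dec-false (far? x) ¬far)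

    ω-far : ∀ x y → Far x → Far y → ω x y ≡ left? x xor left? y
    ω-far x y fx fy =
      cong₂ (λ b c → (b ∧ c) ∧ (left? x xor left? y)) (dec-true (far? x) fx) (dec-true (far? y) fy)

    ω-fibre : ∀ x y → π y ≡ π x → ω x y ≡ false
    ω-fibre x y eq = trans
      (cong (λ a → (does (far? x) ∧ does (far? y)) ∧ (left? x xor does (a ≤? 3 * k))) eq)
      (trans (cong ((does (far? x) ∧ does (far? y)) ∧_) (xor-same (left? x))) (∧-zeroʳ _))

    ω-true : ∀ x y → ω x y ≡ true → Far x × Far y × left? x xor left? y ≡ true
    ω-true x y eq with ∧-true _ _ eq
    ... | fars , split with ∧-true _ _ fars
    ...   | fx , fy = does-true⁻ (far? x) fx , does-true⁻ (far? y) fy , split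

    -- The feet are at least `ℓ - 6k`, hence `12k + 3`, apart, and by `π-step` at most
    -- `h x + 1 + h y`.
    opposite : Adj G x y → π x ≤ 3 * k → ¬ π y ≤ 3 * k → Far y → 12 * k + 2 ≤ h x + h y
    opposite {x} {y} xy πx≤ πy≰ fy with nearest-to-far {x = y} (π≤ y) (h-walk (adj⇒∈ G (symm G xy))) fy
    ... | inj₁ πy≤ = ⊥-elim (πy≰ πy≤)
    ... | inj₂ ℓ≤  = linear 0 (π-step (edgeWalk G xy) ⊕ πx≤ ⊕ ℓ≤ ⊕ long)
                            (identity k (π x) (π y) (h x) (h y) ℓ)
      where
      identity : ∀ k πx πy hx hy l → 12 * k + 2 + (πx + (hx + (1 + hy)) + (3 * k + (πy + 3 * k + l))) + 0 ≡
                                   hx + hy + (πy + (πx + (l + (18 * k + 3))))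
      identity = solve-∀

    crossing-high : Adj G x y → ω x y ≡ true → 12 * k + 2 ≤ h x + h y
    crossing-high {x} {y} xy eq with ω-true x y eq
    ... | fx , fy , split with xor-true (left? x) (left? y) split
    ...   | inj₁ (lx , ly) = opposite xy (does-true⁻ (π x ≤? 3 * k) lx) (does-false⁻ (π y ≤? 3 * k) ly) fy
    ...   | inj₂ (lx , ly) = ≤-trans
      (opposite (symm G xy) (does-true⁻ (π y ≤? 3 * k) ly) (does-false⁻ (π x ≤? 3 * k) lx) fx)
      (≤-reflexive (+-comm (h y) (h x)))

    -- Between far vertices ω is the coboundary of `left?`, so the parity telescopes until the walk
    -- meets a near vertex.
    far-or-near : ∀ {u v} (X : Walk G m u v) → Far u →
                  parity ω X ≡ left? u xor left? v ⊎
                  ∃[ z ] ∃[ a ] ∃[ b ] (¬ Far z × a + b ≡ m × Walk G a u z × Walk G b z v)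
    far-or-near {u = u} (nil _) _ = inj₁ (sym (xor-same (left? u)))
    far-or-near {u = u} {v} (cons {v = w} e X) fu with far? w
    ... | no ¬fw = inj₂ (w , 1 , _ , ¬fw , refl , cons e (nil (source∈ X)) , X)
    ... | yes fw with far-or-near X fw
    ...   | inj₂ (z , a , b , ¬fz , eq , A , B) = inj₂ (z , suc a , b , ¬fz , cong suc eq , cons e A , B)
    ...   | inj₁ eq = inj₁ (begin
      ω u w xor parity ω X                             ≡⟨ cong₂ _xor_ (ω-far u w fu fw) eq ⟩
      (left? u xor left? w) xor (left? w xor left? v)  ≡⟨ xor-assoc (left? u) _ _ ⟩
      left? u xor (left? w xor (left? w xor left? v))  ≡⟨ cong (left? u xor_) (xor-assoc (left? w) _ _) ⟨
      left? u xor ((left? w xor left? w) xor left? v)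
                                                       ≡⟨ cong (λ b → left? u xor (b xor left? v)) (xor-same (left? w)) ⟩
      left? u xor left? v                              ∎)
      where open ≡-Reasoning

    -- Opens an odd closed walk at a crossing edge: `B ++ A` is then an even walk from `y` to `x`,
    -- though these lie on different sides.
    first-crossing : ∀ {u v} (X : Walk G m u v) → parity ω X ≡ true →
                     ∃[ x ] ∃[ y ] ∃[ a ] ∃[ b ] Σ[ A ∈ Walk G a u x ] Σ[ B ∈ Walk G b y v ]
                       (Adj G x y × ω x y ≡ true × parity ω A ≡ false × parity ω B ≡ false × suc (b + a) ≡ m)
    first-crossing {u = u} (cons {v = w} e X) odd with ω u w in eq
    ... | true  = u , w , 0 , _ , nil (adj⇒∈ G e) , X , e , eq , refl , not-injective odd , cong suc (+-identityʳ _)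
    ... | false with first-crossing X odd
    ...   | x , y , a , b , A , B , xy , cross , A-even , B-even , len =
      x , y , suc a , b , cons e A , B , xy , cross ,
      trans (cong (_xor parity ω A) eq) A-even , B-even , cong suc (trans (+-suc b a) len)

    -- The even walk back from `y` to `x` must meet a near vertex `z`, by `far-or-near`. Descending
    -- from `y` to `z` and climbing to `x` takes at least `12k + 2 - 6k` steps, and the crossing
    -- edge is one more.
    odd-long : ∀ {u} (X : Walk G m u u) → parity ω X ≡ true → 6 * k + 3 ≤ m
    odd-long {m} X odd with first-crossing X odd
    ... | x , y , a , b , A , B , xy , cross , A-even , B-even , len with ω-true x y cross
    ...   | _ , fy , split with far-or-near (B ++ A) fy
    ...     | inj₁ eq with () ← trans (sym split) (trans (xor-comm (left? x) (left? y))
                (trans (sym eq) (trans (parity-++ ω B A) (cong₂ _xor_ B-even A-even))))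
    ...     | inj₂ (z , c , d , ¬fz , c+d , C , D) =
      linear 0 (crossing-high xy cross ⊕ h-step C ⊕ h-step (reverse D) ⊕
                near z ¬fz ⊕ near z ¬fz ⊕ ≤-reflexive c+d ⊕ ≤-reflexive len)
             (identity k (h x) (h y) (h z) a b c d m)
      where
      identity : ∀ k x y z a b c d m →
        6 * k + 3 + (x + y + (c + z + (d + z + (3 * k + (3 * k + (b + a + m)))))) + 0 ≡
        m + (12 * k + 2 + (y + (x + (z + (z + (c + d + (1 + (b + a))))))))
      identity = solve-∀

    no-odd-walk : ∀ m {u} (X : Walk G m u u) → parity ω X ≢ true
    no-odd-walk = <-rec (λ m → ∀ {u} (X : Walk G m u u) → parity ω X ≢ true) step
      where
      step : ∀ m → (∀ {e} → e < m → ∀ {u} (X : Walk G e u u) → parity ω X ≢ true) →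
             ∀ {u} (X : Walk G m u u) → parity ω X ≢ true
      -- The induction hypothesis makes `X` a shortest odd closed walk. Two arcs get length k + 1
      -- and the third takes the remainder.
      step m shorter X odd = no-cycle (C.union , C.union⊆ , C.triangle , C.geodesic)
        where
        m≡ : suc k + suc k + (m ∸ (suc k + suc k)) ≡ m
        m≡ = m+[n∸m]≡n (≤-trans (linear 0 (z≤n {4 * k + 1}) (identity k)) (odd-long X odd))
          where
          identity : ∀ k → 1 + k + (1 + k) + (4 * k + 1) + 0 ≡ 6 * k + 3 + 0
          identity = solve-∀
        k<r : suc k ≤ m ∸ (suc k + suc k)
        k<r = +-cancelˡ-≤ (suc k + suc k) _ _
          (≤-trans (≤-trans (linear 0 (z≤n {3 * k}) (identity k)) (odd-long X odd)) (≤-reflexive (sym m≡)))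
          where
          identity : ∀ k → 1 + k + (1 + k) + (1 + k) + 3 * k + 0 ≡ 6 * k + 3 + 0
          identity = solve-∀
        module C = OddCycle G ω ω-sym X odd (λ Z Z-odd → ≮⇒≥ (λ e<m → shorter e<m Z Z-odd))
                            k (m ∸ (suc k + suc k)) m≡ k<r

    -- As walks of this subgraph are even by construction, they can be concatenated, reversed and
    -- produced by `span` without tracking parities.
    uncrossed : Graph n
    uncrossed = record
      { V      = V G
      ; Adj    = λ u v → Adj G u v × ω u v ≡ false
      ; adj?   = λ u v → adj? G u v ×-dec (ω u v Bool.≟ false)
      ; symm   = λ {u} {v} (e , eq) → symm G e , trans (ω-sym v u) eq
      ; irrefl = λ eq (e , _) → irrefl G eq e
      ; adj⇒∈  = λ (e , _) → adj⇒∈ G e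
      }

    even : ∀ {u v} → Walk uncrossed m u v → Σ[ X ∈ Walk G m u v ] parity ω X ≡ false
    even (nil u∈) = nil u∈ , refl
    even (cons (e , eq) X) with even X
    ... | Z , Z-even = cons e Z , cong₂ _xor_ eq Z-even

    uncrossed-foot : x ∈ V G → Walk uncrossed (h x) x (p (π x))
    uncrossed-foot = foot-induction (λ x → Walk uncrossed (h x) x (p (π x))) base up
      where
      base : i ≤ ℓ → Walk uncrossed (h (p i)) (p i) (p (π (p i)))
      base {i} i≤ = subst₂ (λ m j → Walk uncrossed m (p i) (p j)) (sym (h-p i≤)) (sym (π-p i≤)) (nil (p∈ i))
      up : Adj G x y → π y ≡ π x → h x ≡ suc (h y) → Walk uncrossed (h y) y (p (π y)) →
           Walk uncrossed (h x) x (p (π x))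
      up {x} {y} xy πeq heq X =
        subst₂ (λ m j → Walk uncrossed m x (p j)) (sym heq) πeq (cons (xy , ω-fibre x y πeq) X)

    p-near : i ≤ ℓ → ¬ Far (p i)
    p-near i≤ far = <⇒≱ (m≤n+m 1 (3 * k)) (≤-trans far (≤-trans (≤-reflexive (h-p i≤)) z≤n))

    uncrossed-line : i ≤ ℓ → j ≤ ℓ → ∃[ m ] Walk uncrossed m (p i) (p j)
    -- The half-width `i + j` is large enough for the window to impose no restriction.
    uncrossed-line {i} {j} i≤ j≤ with span {i = j} {H = uncrossed} p {i} {i + j} {ℓ}
      (λ {l} l< _ _ → p-step l< , ω-near (p l) (p (suc l)) (p-near (<⇒≤ l<))) i≤ (p∈ i) (p∈ j) j≤
      (≤-trans (m≤n+m j i) (m≤n+m (i + j) i)) (≤-trans (m≤m+n i j) (m≤n+m (i + j) j))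
    ... | m , _ , X = m , X

    -- A crossing edge would close up through P to an odd walk.
    no-crossing : Adj G x y → ω x y ≡ false
    no-crossing {x} {y} xy with ω x y in eq
    ... | false = refl
    ... | true with uncrossed-line (π≤ y) (π≤ x)
    ...   | _ , line with even (uncrossed-foot (adj⇒∈ G (symm G xy)) ++ line ++
                                reverse (uncrossed-foot (adj⇒∈ G xy)))
    ...     | X , X-even = ⊥-elim (no-odd-walk _ (cons xy X) (cong₂ _xor_ eq X-even))

    -- Up to its first exit the walk uses only edges between far vertices, and since none of them
    -- crosses, the side never changes.
    leave-far : ∀ {u v} → Walk G m u v → Far u → ¬ Far v →
                ∃[ y ] ∃[ z ] ∃[ a ] ∃[ b ] (Far y × ¬ Far z × left? y ≡ left? u × Adj G y z ×
                                             Walk G a u y × Walk G b z v × suc (a + b) ≡ m)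
    leave-far (nil _) fu ¬fv = ⊥-elim (¬fv fu)
    leave-far {u = u} (cons {v = w} e X) fu ¬fv with far? w
    ... | no ¬fw = u , w , 0 , _ , fu , ¬fw , refl , e , nil (adj⇒∈ G e) , X , refl
    ... | yes fw with leave-far X fw ¬fv
    ...   | y , z , a , b , fy , ¬fz , side , yz , A , B , len =
      y , z , suc a , b , fy , ¬fz , trans side (sym same) , yz , cons e A , B , cong suc len
      where
      same : left? u ≡ left? w
      same = xor-false (left? u) (left? w) (trans (sym (ω-far u w fu fw)) (no-crossing e))

    module _ {v} (v∈ : v ∈ V G) (high : 9 * k < h v) where

      private
        v-far : Far v
        v-far = linear 0 (high ⊕ z≤n {6 * k}) (identity k (h v))
          where
          identity : ∀ k h → 3 * k + 1 + (h + 6 * k) + 0 ≡ h + (1 + 9 * k + 0)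
          identity = solve-∀

        -- Leaving the far zone takes at least 6k + 1 steps.
        too-long : ∀ {y z a b} → ¬ Far z → Adj G y z → Walk G a v y → suc (a + b) ≤ ℓ → ¬ ℓ ≤ 6 * k + b
        too-long {y} {z} {a} {b} ¬fz yz A len ℓ≤ = <⇒≱ (n<1+n 0)
          (linear 0 (high ⊕ h-step (snoc A yz) ⊕ near z ¬fz ⊕ len ⊕ ℓ≤) (identity k (h v) (h z) a b ℓ))
          where
          identity : ∀ k v z a b l → 1 + (v + (1 + a + z + (3 * k + (l + (6 * k + b))))) + 0 ≡
                                     0 + (1 + 9 * k + (v + (z + (1 + (a + b) + l))))
          identity = solve-∀

        exit-height : ∀ {y z} → Far y → ¬ Far z → Adj G y z → h y ≡ suc (h z)
        exit-height {y} {z} fy ¬fz yz = ≤-antisym (h-step (edgeWalk G yz))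
          (≤-trans (s≤s (near z ¬fz)) (≤-trans (≤-reflexive (+-comm 1 _)) fy))

        -- Height drops by exactly one along `yz`, so the foot of `z` is also nearest to `y`. The
        -- claw argument at `y` thus locates the foot of the near vertex `z`, about which it says
        -- nothing directly.
        exit-nearest : ∀ {y z} → Far y → ¬ Far z → Adj G y z → π z ≤ 3 * k ⊎ ℓ ≤ π z + 3 * k
        exit-nearest {y} {z} fy ¬fz yz = nearest-to-far {x = y} (π≤ z)
          (subst (λ m → Walk G m y (p (π z))) (sym (exit-height fy ¬fz yz))
                 (cons yz (h-walk (adj⇒∈ G (symm G yz))))) fy

        -- Such feet would be at least `12k + 3` apart, while the detour over the edge has length at
        -- most `6k + 2`.
        apart : ∀ {x y} → Adj G x y → h x + h y ≤ 6 * k + 1 → π x ≤ 3 * k → ¬ ℓ ≤ π y + 3 * k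
        apart {x} {y} xy low πx≤ ℓ≤ = <⇒≱ (n<1+n 0)
          (linear (6 * k) (π-step (edgeWalk G xy) ⊕ low ⊕ πx≤ ⊕ ℓ≤ ⊕ long)
                  (identity k (π x) (π y) (h x) (h y) ℓ))
          where
          identity : ∀ k px py x y l →
            1 + (px + (x + (1 + y)) + (6 * k + 1 + (3 * k + (py + 3 * k + l)))) + 6 * k ≡
            0 + (py + (x + y + (px + (l + (18 * k + 3)))))
          identity = solve-∀

        exit-low : ∀ {y z} → Far y → ¬ Far z → Adj G y z → h y + h z ≤ 6 * k + 1
        exit-low {y} {z} fy ¬fz yz =
          linear 0 (≤-reflexive (exit-height fy ¬fz yz) ⊕ near z ¬fz ⊕ near z ¬fz) (identity k (h y) (h z))
          where
          identity : ∀ k y z → y + z + (1 + z + (3 * k + 3 * k)) + 0 ≡ 6 * k + 1 + (y + (z + z))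
          identity = solve-∀

      -- A shortest walk from `v` to the end of P on the other side has length at most ℓ. It leaves
      -- the far zone at a vertex `z` whose foot is still within 3k of the end on the side of `v`,
      -- by `apart`, so at least `ℓ - 6k` steps remain after `z`.
      no-high-vertex : ⊥
      no-high-vertex with left? v in side
      ... | true with leave-far (δ-walk v∈ (p∈ ℓ)) v-far (p-near ≤-refl)
      ...   | y , z , a , b , fy , ¬fz , same , yz , A , B , len with exit-nearest fy ¬fz yz
      ...     | inj₂ ℓ≤ = apart yz (exit-low fy ¬fz yz) (does-true⁻ (π y ≤? 3 * k) (trans same side)) ℓ≤
      ...     | inj₁ πz≤ = too-long ¬fz yz A (≤-trans (≤-reflexive len) (diameter v∈ (p∈ ℓ)))
        (linear 0 (π-unique ≤-refl B ⊕ πz≤ ⊕ near z ¬fz) (identity k (π z) (h z) b ℓ))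
        where
        identity : ∀ k pz z b l → l + (pz + (z + b) + (3 * k + 3 * k)) + 0 ≡ 6 * k + b + (l + (pz + z))
        identity = solve-∀
      no-high-vertex | false with leave-far (δ-walk v∈ (p∈ 0)) v-far (p-near z≤n)
      ...   | y , z , a , b , fy , ¬fz , same , yz , A , B , len
        with exit-nearest fy ¬fz yz | nearest-to-far {x = y} (π≤ y) (h-walk (adj⇒∈ G yz)) fy
      ...     | _       | inj₁ πy≤ = does-false⁻ (π y ≤? 3 * k) (trans same side) πy≤
      ...     | inj₁ πz≤ | inj₂ ℓ≤ =
        apart (symm G yz) (≤-trans (≤-reflexive (+-comm (h z) (h y))) (exit-low fy ¬fz yz)) πz≤ ℓ≤
      ...     | inj₂ ℓ≤ | inj₂ _   = too-long ¬fz yz A (≤-trans (≤-reflexive len) (diameter v∈ (p∈ 0)))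
        (linear 0 (π-unique′ z≤n B ⊕ ℓ≤ ⊕ near z ¬fz) (identity k (π z) (h z) b ℓ))
        where
        identity : ∀ k pz z b l → l + (0 + (b + z) + (pz + 3 * k + 3 * k)) + 0 ≡ 6 * k + b + (pz + (l + z))
        identity = solve-∀

  height≤ : x ∈ V G → h x ≤ 9 * k
  height≤ x∈ = ≮⇒≥ (no-high-vertex x∈)

-- A diametral pair, and the two cases of the construction

diameter-pair : (G : Graph n) (conn : Connected G) → let open Metric G conn in
                ∃[ s ] ∃[ t ] (s ∈ V G × t ∈ V G × (∀ {u v} → u ∈ V G → v ∈ V G → δ u v ≤ δ s t))
diameter-pair G conn =
  s , farthest s , s∈ , farthest∈ s , λ {u} u∈ v∈ → ≤-trans (proj₂ (proj₂ (ecc u)) v∈) (max u∈)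
  where
  open Metric G conn
  o∈ = proj₂ (proj₁ conn)
  ecc : ∀ u → ∃[ y ] (y ∈ V G × (∀ {z} → z ∈ V G → δ u z ≤ δ u y))
  ecc u = maximum (_∈? V G) (δ u) o∈
  farthest : Fin _ → Fin _
  farthest u = proj₁ (ecc u)
  farthest∈ : ∀ u → farthest u ∈ V G
  farthest∈ u = proj₁ (proj₂ (ecc u))
  best = maximum (_∈? V G) (λ u → δ u (farthest u)) o∈
  s = proj₁ best
  s∈ = proj₁ (proj₂ best)
  max : ∀ {u} → u ∈ V G → δ u (farthest u) ≤ δ s (farthest s)
  max = proj₂ (proj₂ best)

theorem2 : ∀ (k : ℕ) {n : ℕ} (G : Graph n) → Connected G →
    ¬ (∃[ Y ] (Y ⊆ᴳ G × Subdivision≥ k (completeGraph 3) Y × Geodesic Y G)) →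
    ¬ (∃[ Y ] (Y ⊆ᴳ G × Subdivision≥ (3 * k) (completeBipartite 1 3) Y × QuasiGeodesic 3 Y G)) →
    ∃[ ℓ ] ((∃[ D ] (Decomposition.Honest {H = pathGraph ℓ} {G = G} D
    × Decomposition.RadialWidth≤ D (18 * k + 2)
    × Decomposition.RadialSpread≤ D (18 * k + 1)))
    × QuasiIsometric 1 (18 * k + 2) (pathGraph ℓ) G)
theorem2 k G conn no-cycle no-claw with diameter-pair G conn
... | s , t , s∈ , t∈ , diameter with Metric.δ G conn s t ≤? 18 * k + 2
...   | yes short =
  0 , (T.decomposition , T.honest , T.radial-width short , T.radial-spread z≤n) , T.quasi-isometric short
  where
  module M = Metric G conn
  module P = M.Projection (nil s∈) (λ _ → z≤n)
  -- P is the single vertex `s`; heights are distances to `s` and hence at most the diameter, and π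
  -- is constantly 0.
  module T = P.Thickening (M.δ s t) 0 (λ x∈ → diameter x∈ s∈) (λ {_} {y} _ → ≤-trans (P.π≤ y) z≤n)
...   | no ¬short =
  M.δ s t , (T.decomposition , T.honest , T.radial-width width , T.radial-spread spread) , T.quasi-isometric dense
  where
  module M = Metric G conn
  W = M.δ-walk s∈ t∈
  module P = M.Projection W M.δ-min
  module D = Diametral k G conn no-cycle no-claw W M.δ-min diameter
               (≤-trans (≤-reflexive (+-suc (18 * k) 2)) (≰⇒> ¬short))
  -- `π-step` allows a move of `18k + 1`, odd and therefore one less than twice the half-width.
  jump : ∀ {x y} → Adj G x y → P.π y ≤ P.π x + (9 * k + 1 + (9 * k + 1))
  jump {x} {y} xy =
    linear 1 (P.π-step (edgeWalk G xy) ⊕ D.height≤ (adj⇒∈ G xy) ⊕ D.height≤ (adj⇒∈ G (symm G xy)))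
             (identity k (P.π x) (P.π y) (P.h x) (P.h y))
    where
    identity : ∀ k px py x y → py + (px + (x + (1 + y)) + (9 * k + 9 * k)) + 1 ≡
                               px + (9 * k + 1 + (9 * k + 1)) + (py + (x + y))
    identity = solve-∀
  module T = P.Thickening (9 * k) (9 * k + 1) D.height≤ jump
  width : 9 * k + 1 + 9 * k ≤ 18 * k + 2
  width = linear 0 (z≤n {1}) (identity k)
    where
    identity : ∀ k → 9 * k + 1 + 9 * k + 1 + 0 ≡ 18 * k + 2 + 0
    identity = solve-∀
  spread : 9 * k + 1 ≤ 18 * k + 1
  spread = linear 0 (z≤n {9 * k}) (identity k)
    where
    identity : ∀ k → 9 * k + 1 + 9 * k + 0 ≡ 18 * k + 1 + 0
    identity = solve-∀
  dense : 9 * k ≤ 18 * k + 2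
  dense = linear 0 (z≤n {9 * k + 2}) (identity k)
    where
    identity : ∀ k → 9 * k + (9 * k + 2) + 0 ≡ 18 * k + 2 + 0
    identity = solve-∀
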